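{- For every even integer $n\ge 0$, the polynomial $\frac{1-q^{3n+1}}{1-q}C_n(q)$ is symmetric and unimodal (its coefficient sequence is palindromic and weakly increases up to its middle and weakly decreases afterwards).
   Context: The $q$-Catalan polynomial is $C_n(q)=\frac{1-q}{1-q^{n+1}}{2n\brack n}$, where ${n\brack m}=\prod_{i=0}^{m-1}\frac{1-q^{n-i}}{1-q^{m-i}}$ is the Gaussian polynomial; $C_n(q)$ is a polynomial in $q$. -}

module Defs where

open import Algebra.Properties.Semiring.Sum using (sum)
open import Data.Bool.Base using (if_then_else_)
open import Data.Fin.Base as Fin using (Fin; toℕ)
open import Data.Integer.Base as ℤ using (ℤ; 0ℤ; 1ℤ)
open import Data.Integer.Properties using (+-*-semiring)
import Data.Integer.Properties as ℤₚ
open import Data.Nat.Base using (ℕ; zero; suc; _+_; _*_; _∸_; _≤_; _<_; ⌊_/2⌋; NonZero; s≤s)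
open import Data.Nat.Divisibility using (_∣_; _∣?_; ∣m+n∣m⇒∣n; ∣m∣n⇒∣m+n; ∣-refl; ∣⇒≤; _∣0)
open import Data.Nat.Properties using (_≟_; _≤?_; m+[n∸m]≡n; ≰⇒>)
open import Data.Product.Base using (_×_; ∃-syntax)
open import Data.Vec.Functional using (foldr)
open import Function.Base using (_∘_)
open import Relation.Binary.PropositionalEquality
open import Relation.Nullary using (yes; no)
open import Relation.Nullary.Decidable using (does; dec-true; dec-false)

-- Formal power series in q over ℤ: `f k` is the coefficient of q^k.  Rational
-- functions of q whose denominator has constant term 1 embed in this ring, so
-- the quotients below can be written down before they are known to be polynomials.
Series : Set
Series = ℕ → ℤ

q^_ : ℕ → Series
(q^ k) j = if does (k ≟ j) then 1ℤ else 0ℤ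

infixl 7 _⊛_

_⊛_ : Series → Series → Series
(f ⊛ g) k = sum +-*-semiring {suc k} λ i → f (toℕ i) ℤ.* g (k ∸ toℕ i)

∏ : ∀ {n} → (Fin n → Series) → Series
∏ = foldr _⊛_ (q^ 0)

1-q^_ : ℕ → Series
(1-q^ k) j = (q^ 0) j ℤ.- (q^ k) j

-- 1/(1 - q^k) = ∑_j q^(jk) for k > 0 (see 1-q^-inverse); only used for k > 0.
1/1-q^_ : ℕ → Series
(1/1-q^ k) j = if does (k ∣? j) then 1ℤ else 0ℤ

-- (1 - q^a)/(1 - q^b)
ratio : ℕ → ℕ → Series
ratio a b = (1-q^ a) ⊛ (1/1-q^ b)

-- For m > n the truncation in n ∸ i is harmless: the factor i = n is already 0.
gaussian : ℕ → ℕ → Series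
gaussian n m = ∏ {m} λ i → ratio (n ∸ toℕ i) (m ∸ toℕ i)

qCatalan : ℕ → Series
qCatalan n = ratio 1 (n + 1) ⊛ gaussian (2 * n) n

HasDegree : Series → ℕ → Set
HasDegree f d = f d ≢ 0ℤ × (∀ k → d < k → f k ≡ 0ℤ)

Palindromic : Series → ℕ → Set
Palindromic f d = ∀ k → k ≤ d → f k ≡ f (d ∸ k)

UnimodalAtMiddle : Series → ℕ → Set
UnimodalAtMiddle f d =
  (∀ i j → i ≤ j → j ≤ ⌊ d /2⌋ → f i ℤ.≤ f j) ×
  (∀ i j → ⌊ d /2⌋ ≤ i → i ≤ j → j ≤ d → f j ℤ.≤ f i)

-- In particular, f is a (nonzero) polynomial.
IsSymmetricUnimodalPolynomial : Series → Set
IsSymmetricUnimodalPolynomial f =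
  ∃[ d ] HasDegree f d × Palindromic f d × UnimodalAtMiddle f d

private
  ∑ : ∀ {n} → (Fin n → ℤ) → ℤ
  ∑ = sum +-*-semiring

  ∑-zero : ∀ {n} (t : Fin n → ℤ) → (∀ i → t i ≡ 0ℤ) → ∑ t ≡ 0ℤ
  ∑-zero {zero}  t t≡0 = refl
  ∑-zero {suc n} t t≡0 = cong₂ ℤ._+_ (t≡0 Fin.zero) (∑-zero (t ∘ Fin.suc) (t≡0 ∘ Fin.suc))

  -- ∑_{i ≤ j} -[i = k] g (j - i)
  shift : Series → ℕ → ℕ → ℤ
  shift g k j = ∑ {suc j} λ i → (0ℤ ℤ.- (q^ k) (toℕ i)) ℤ.* g (j ∸ toℕ i)

  shift-≤ : ∀ g k j → k ≤ j → shift g k j ≡ ℤ.- g (j ∸ k)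
  shift-≤ g zero j _ = trans
    (cong₂ ℤ._+_ (ℤₚ.-1*i≡-i (g j)) (∑-zero {j} _ λ _ → refl))
    (ℤₚ.+-identityʳ _)
  shift-≤ g (suc k) (suc j) (s≤s k≤j) = trans (ℤₚ.+-identityˡ _) (shift-≤ g k j k≤j)

  shift-> : ∀ g k j → j < k → shift g k j ≡ 0ℤ
  shift-> g (suc k) zero    _         = refl
  shift-> g (suc k) (suc j) (s≤s j<k) = trans (ℤₚ.+-identityˡ _) (shift-> g k j j<k)

  peel : ∀ g k j → ((1-q^ suc k) ⊛ g) j ≡ g j ℤ.+ shift g (suc k) j
  peel g k j = cong₂ ℤ._+_ (ℤₚ.*-identityˡ (g j)) (sym (ℤₚ.+-identityˡ _))

  periodic : ∀ k j → k ≤ j → (1/1-q^ k) j ≡ (1/1-q^ k) (j ∸ k)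
  periodic k j k≤j with k ∣? (j ∸ k)
  ... | yes k∣ = cong (if_then 1ℤ else 0ℤ) (dec-true (k ∣? j)
                   (subst (k ∣_) (m+[n∸m]≡n k≤j) (∣m∣n⇒∣m+n ∣-refl k∣)))
  ... | no  k∤ = cong (if_then 1ℤ else 0ℤ) (dec-false (k ∣? j)
                   λ k∣j → k∤ (∣m+n∣m⇒∣n (subst (k ∣_) (sym (m+[n∸m]≡n k≤j)) k∣j) ∣-refl))

1-q^-inverse : ∀ k .{{_ : NonZero k}} j → ((1-q^ k) ⊛ (1/1-q^ k)) j ≡ (q^ 0) j
1-q^-inverse (suc k) j = trans (peel (1/1-q^ suc k) k j) (go j)
  where
  g = 1/1-q^ suc k
  go : ∀ j → g j ℤ.+ shift g (suc k) j ≡ (q^ 0) j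
  go zero = cong (ℤ._+ 0ℤ) (cong (if_then 1ℤ else 0ℤ) (dec-true (suc k ∣? 0) (suc k ∣0)))
  go (suc j) with suc k ≤? suc j
  ... | yes k≤j = trans
    (cong₂ ℤ._+_ (periodic (suc k) (suc j) k≤j) (shift-≤ g (suc k) (suc j) k≤j))
    (ℤₚ.+-inverseʳ (g (j ∸ k)))
  ... | no  k≰j = cong₂ ℤ._+_
    (cong (if_then 1ℤ else 0ℤ) (dec-false (suc k ∣? suc j) (k≰j ∘ ∣⇒≤)))
    (shift-> g (suc k) (suc j) (≰⇒> k≰j))

{-# OPTIONS --safe #-}
module Submission where

-- Write [a,b] for the Gaussian polynomial.  Pascal's rules turn (1 - q^(3n+1))/(1 - q) C_n(q) into
-- [2n+2,n] - q^(n+2) [2n,n-2].  Put m = n + 2 and let V be the irreducible sl₂-module of dimension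
-- m + 1, with basis x_0, …, x_m.  The two terms are the characters of S^n V and of S^(n-2) V, the latter
-- shifted by the weight of the invariant quadratic form, which exists because m is even.  So the difference
-- is the character of the harmonic polynomials of degree n, an sl₂-module, and is unimodal.
--
-- In elementary terms: let X be the raising operator, Δ the Laplacian and Q the multiplication by the
-- quadratic form.  Below the middle weight the map (p, r) ↦ (Xp + Qr, Δp) is injective, because
-- [Δ,X] = 0 and both Δ ∘ Q and Y ∘ X are injective (Y the lowering operator); comparing dimensions gives
-- the inequality between neighbouring coefficients.

open import Algebra.Bundles using (CommutativeSemiring; Ring)
import Algebra.Properties.Ring
import Algebra.Properties.Semiring.Sum
open import Data.Bool.Base using (true; false; if_then_else_)
open import Data.Fin.Base as Fin using (Fin; fromℕ; inject₁; opposite; punchIn; punchOut; toℕ)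
open import Data.Fin.Permutation using (reverse)
import Data.Fin.Properties as Finₚ
open import Data.Nat.Base as ℕ using (ℕ; zero; suc)
open import Function.Base using (_∘_; id)
open import Relation.Binary.PropositionalEquality as ≡ using (_≡_; refl; cong)
import Relation.Binary.Reasoning.Setoid
open import Relation.Nullary using (Dec; yes; no; does; ¬_; contradiction)

-- Commutators and the Weyl algebra

-- All coefficients are integers, so the argument is arranged to avoid division and any
-- decomposition into irreducible modules. Injectivity comes from positive commutators alone: a
-- solution of DUp = -λp with λ ≥ 0 is pushed down a grading until it lands in an empty piece.
-- Dimensions are then compared by elimination without fractions. The space of harmonic polynomials
-- itself never appears. Its dimension would require the surjectivity of Δ; the extra summand r
-- takes the place of that. If h_j and g_j are the coefficients of [2n+2,n] and q^(n+2) [2n,n-2],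
-- one injective map between sums of two graded pieces gives h_j + g_(j+1) ≤ h_(j+1) + g_j, and
-- moving terms across gives the growth of h - g. The quotient in the theorem starts as a power
-- series. That it is a polynomial, and of which degree, is read off from h - g.

module Commutator {c ℓ} (R : Ring c ℓ) where
  open Ring R hiding (refl)
  open Algebra.Properties.Ring R
  open Algebra.Properties.Semiring.Sum semiring
  open Relation.Binary.Reasoning.Setoid setoid

  [_,_] : Carrier → Carrier → Carrier
  [ a , b ] = a * b - b * a

  swap : ∀ a b → a * b ≈ b * a + [ a , b ]
  swap a b = begin
    a * b                        ≈⟨ +-identityˡ (a * b) ⟨
    0# + a * b                   ≈⟨ +-congʳ (-‿inverseʳ (b * a)) ⟨
    b * a - b * a + a * b        ≈⟨ +-assoc (b * a) (- (b * a)) (a * b) ⟩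
    b * a + (- (b * a) + a * b)  ≈⟨ +-congˡ (+-comm (- (b * a)) (a * b)) ⟩
    b * a + [ a , b ]            ∎

  [,]-unique : ∀ {a b d} → a * b ≈ b * a + d → [ a , b ] ≈ d
  [,]-unique {a} {b} {d} ab≈ba+d = begin
    a * b - b * a          ≈⟨ +-congʳ ab≈ba+d ⟩
    b * a + d - b * a      ≈⟨ +-congʳ (+-comm (b * a) d) ⟩
    d + b * a - b * a      ≈⟨ +-assoc d (b * a) (- (b * a)) ⟩
    d + (b * a - b * a)    ≈⟨ +-congˡ (-‿inverseʳ (b * a)) ⟩
    d + 0#                 ≈⟨ +-identityʳ d ⟩
    d                      ∎

  [,]-antisym : ∀ a b → [ a , b ] ≈ - [ b , a ]
  [,]-antisym a b = [,]-unique (begin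
    a * b                                ≈⟨ +-identityʳ (a * b) ⟨
    a * b + 0#                           ≈⟨ +-congˡ (-‿inverseʳ [ b , a ]) ⟨
    a * b + ([ b , a ] - [ b , a ])      ≈⟨ +-assoc (a * b) [ b , a ] (- [ b , a ]) ⟨
    a * b + [ b , a ] - [ b , a ]        ≈⟨ +-congʳ (swap b a) ⟨
    b * a - [ b , a ]                    ∎)

  [,]-*ʳ : ∀ a b d → [ a , b * d ] ≈ [ a , b ] * d + b * [ a , d ]
  [,]-*ʳ a b d = [,]-unique (begin
    a * (b * d)                                      ≈⟨ *-assoc a b d ⟨
    a * b * d                                        ≈⟨ *-congʳ (swap a b) ⟩
    (b * a + [ a , b ]) * d                          ≈⟨ distribʳ d (b * a) [ a , b ] ⟩
    b * a * d + [ a , b ] * d                        ≈⟨ +-congʳ (*-assoc b a d) ⟩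
    b * (a * d) + [ a , b ] * d                      ≈⟨ +-congʳ (*-congˡ (swap a d)) ⟩
    b * (d * a + [ a , d ]) + [ a , b ] * d          ≈⟨ +-congʳ (distribˡ b (d * a) [ a , d ]) ⟩
    b * (d * a) + b * [ a , d ] + [ a , b ] * d      ≈⟨ +-assoc (b * (d * a)) (b * [ a , d ]) ([ a , b ] * d) ⟩
    b * (d * a) + (b * [ a , d ] + [ a , b ] * d)    ≈⟨ +-cong (sym (*-assoc b d a)) (+-comm (b * [ a , d ]) ([ a , b ] * d)) ⟩
    b * d * a + ([ a , b ] * d + b * [ a , d ])      ∎)

  [,]-*ˡ : ∀ a b d → [ a * b , d ] ≈ a * [ b , d ] + [ a , d ] * b
  [,]-*ˡ a b d = begin
    [ a * b , d ]                            ≈⟨ [,]-antisym (a * b) d ⟩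
    - [ d , a * b ]                          ≈⟨ -‿cong ([,]-*ʳ d a b) ⟩
    - ([ d , a ] * b + a * [ d , b ])        ≈⟨ -‿+-comm ([ d , a ] * b) (a * [ d , b ]) ⟨
    - ([ d , a ] * b) + - (a * [ d , b ])    ≈⟨ +-cong (-‿distribˡ-* [ d , a ] b) (-‿distribʳ-* a [ d , b ]) ⟩
    - [ d , a ] * b + a * - [ d , b ]        ≈⟨ +-cong (*-congʳ ([,]-antisym a d)) (*-congˡ ([,]-antisym b d)) ⟨
    [ a , d ] * b + a * [ b , d ]            ≈⟨ +-comm ([ a , d ] * b) (a * [ b , d ]) ⟩
    a * [ b , d ] + [ a , d ] * b            ∎

  [,]-+ʳ : ∀ a b d → [ a , b + d ] ≈ [ a , b ] + [ a , d ]
  [,]-+ʳ a b d = [,]-unique (begin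
    a * (b + d)                                  ≈⟨ distribˡ a b d ⟩
    a * b + a * d                                ≈⟨ +-cong (swap a b) (swap a d) ⟩
    (b * a + [ a , b ]) + (d * a + [ a , d ])    ≈⟨ +-assoc (b * a) [ a , b ] (d * a + [ a , d ]) ⟩
    b * a + ([ a , b ] + (d * a + [ a , d ]))    ≈⟨ +-congˡ (+-assoc [ a , b ] (d * a) [ a , d ]) ⟨
    b * a + ([ a , b ] + d * a + [ a , d ])      ≈⟨ +-congˡ (+-congʳ (+-comm [ a , b ] (d * a))) ⟩
    b * a + (d * a + [ a , b ] + [ a , d ])      ≈⟨ +-congˡ (+-assoc (d * a) [ a , b ] [ a , d ]) ⟩
    b * a + (d * a + ([ a , b ] + [ a , d ]))    ≈⟨ +-assoc (b * a) (d * a) ([ a , b ] + [ a , d ]) ⟨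
    b * a + d * a + ([ a , b ] + [ a , d ])      ≈⟨ +-congʳ (distribʳ a b d) ⟨
    (b + d) * a + ([ a , b ] + [ a , d ])        ∎)

  [,]-sumʳ : ∀ {n} a (t : Fin n → Carrier) → [ a , sum t ] ≈ sum (λ i → [ a , t i ])
  [,]-sumʳ {zero}  a t = [,]-unique (begin
    a * 0#         ≈⟨ zeroʳ a ⟩
    0#             ≈⟨ zeroˡ a ⟨
    0# * a         ≈⟨ +-identityʳ (0# * a) ⟨
    0# * a + 0#    ∎)
  [,]-sumʳ {suc n} a t = trans ([,]-+ʳ a (t Fin.zero) (sum (t ∘ Fin.suc))) (+-congˡ ([,]-sumʳ a (t ∘ Fin.suc)))

  sum-cong : ∀ {n} {s t : Fin n → Carrier} → (∀ i → s i ≈ t i) → sum s ≈ sum t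
  sum-cong = sum-cong-≋

  sum-neg : ∀ {n} (t : Fin n → Carrier) → sum (λ i → - t i) ≈ - sum t
  sum-neg {zero}  t = sym -0#≈0#
  sum-neg {suc n} t = trans (+-congˡ (sum-neg (t ∘ Fin.suc))) (-‿+-comm (t Fin.zero) (sum (t ∘ Fin.suc)))

  [,]-sumˡ : ∀ {n} (t : Fin n → Carrier) a → [ sum t , a ] ≈ sum (λ i → [ t i , a ])
  [,]-sumˡ t a = begin
    [ sum t , a ]                  ≈⟨ [,]-antisym (sum t) a ⟩
    - [ a , sum t ]                ≈⟨ -‿cong ([,]-sumʳ a t) ⟩
    - sum (λ i → [ a , t i ])      ≈⟨ sum-neg (λ i → [ a , t i ]) ⟨
    sum (λ i → - [ a , t i ])      ≈⟨ sum-cong (λ i → [,]-antisym (t i) a) ⟨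
    sum (λ i → [ t i , a ])        ∎

  sum-opposite : ∀ {n} (t : Fin n → Carrier) → sum (t ∘ opposite) ≈ sum t
  sum-opposite t = sym (sum-permute t reverse)

  δ : ∀ {n} → Fin n → Fin n → Carrier
  δ i j = if does (i Finₚ.≟ j) then 1# else 0#

  δ-inject₁ : ∀ {n} (i j : Fin n) → δ (inject₁ i) (inject₁ j) ≡ δ i j
  δ-inject₁ Fin.zero    Fin.zero    = refl
  δ-inject₁ Fin.zero    (Fin.suc j) = refl
  δ-inject₁ (Fin.suc i) Fin.zero    = refl
  δ-inject₁ (Fin.suc i) (Fin.suc j) = δ-inject₁ i j

  δ-sym : ∀ {n} (i j : Fin n) → δ i j ≡ δ j i
  δ-sym Fin.zero    Fin.zero    = refl
  δ-sym Fin.zero    (Fin.suc j) = refl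
  δ-sym (Fin.suc i) Fin.zero    = refl
  δ-sym (Fin.suc i) (Fin.suc j) = δ-sym i j

  δ-central : ∀ {n} (i j : Fin n) a → δ i j * a ≈ a * δ i j
  δ-central i j a with does (i Finₚ.≟ j)
  ... | true  = trans (*-identityˡ a) (sym (*-identityʳ a))
  ... | false = trans (zeroˡ a) (sym (zeroʳ a))

  sum-zero : ∀ {n} (t : Fin n → Carrier) → (∀ i → t i ≈ 0#) → sum t ≈ 0#
  sum-zero {n} t t≈0 = trans (sum-cong t≈0) (sum-replicate-zero n)

  sum-δˡ : ∀ {n} i (t : Fin n → Carrier) → sum (λ j → δ i j * t j) ≈ t i
  sum-δˡ Fin.zero    t = trans
    (+-cong (*-identityˡ (t Fin.zero)) (sum-zero (λ j → 0# * t (Fin.suc j)) (λ j → zeroˡ (t (Fin.suc j)))))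
    (+-identityʳ (t Fin.zero))
  sum-δˡ (Fin.suc i) t = trans
    (+-cong (zeroˡ (t Fin.zero)) (sum-δˡ i (t ∘ Fin.suc)))
    (+-identityˡ (t (Fin.suc i)))

  sum-δʳ : ∀ {n} i (t : Fin n → Carrier) → sum (λ j → t j * δ i j) ≈ t i
  sum-δʳ i t = trans (sum-cong λ j → sym (δ-central i j (t j))) (sum-δˡ i t)

  [,]-central : ∀ {s} → (∀ b → s * b ≈ b * s) → ∀ a b → [ a , s * b ] ≈ s * [ a , b ]
  [,]-central {s} central a b = begin
    [ a , s * b ]                  ≈⟨ [,]-*ʳ a s b ⟩
    [ a , s ] * b + s * [ a , b ]  ≈⟨ +-congʳ (*-congʳ ([,]-unique (trans (sym (central a)) (sym (+-identityʳ (s * a)))))) ⟩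
    0# * b + s * [ a , b ]         ≈⟨ +-congʳ (zeroˡ b) ⟩
    0# + s * [ a , b ]             ≈⟨ +-identityˡ (s * [ a , b ]) ⟩
    s * [ a , b ]                  ∎

  -- The signs s in X are what makes Δ invariant; signs odd under l ↦ m - 1 - l exist only for even m.
  module Weyl {m} (x ∂ : Fin (suc m) → Carrier)
    (x-comm  : ∀ i j → x i * x j ≈ x j * x i)
    (∂-comm  : ∀ i j → ∂ i * ∂ j ≈ ∂ j * ∂ i)
    (∂-x     : ∀ i j → ∂ i * x j ≈ x j * ∂ i + δ i j)
    (s t : Fin m → Carrier)
    (s-central : ∀ l a → s l * a ≈ a * s l)
    (t-central : ∀ l a → t l * a ≈ a * t l)
    (s-odd : ∀ l → s (opposite l) ≈ - s l)
    where

    -- `X` and `Y` extend to polynomials, as derivations, the maps x_l ↦ s_l x_(l+1) and x_(l+1) ↦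
    -- t_l x_l of V. Only the products t_l s_l enter [Y,X], so t is left free until the eigenvalues
    -- are chosen.
    X Y Δ Q : Carrier
    X = sum λ l → s l * (x (Fin.suc l) * ∂ (inject₁ l))
    Y = sum λ l → t l * (x (inject₁ l) * ∂ (Fin.suc l))
    Δ = sum λ i → ∂ i * ∂ (opposite i)
    Q = sum λ i → x i * x (opposite i)

    [∂,x]≈δ : ∀ i j → [ ∂ i , x j ] ≈ δ i j
    [∂,x]≈δ i j = [,]-unique (∂-x i j)

    [∂,∂]≈0 : ∀ i j → [ ∂ i , ∂ j ] ≈ 0#
    [∂,∂]≈0 i j = [,]-unique (trans (∂-comm i j) (sym (+-identityʳ (∂ j * ∂ i))))

    [x,x]≈0 : ∀ i j → [ x i , x j ] ≈ 0#
    [x,x]≈0 i j = [,]-unique (trans (x-comm i j) (sym (+-identityʳ (x j * x i))))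

    -- No term of `X` contains x_0, hence the zero in the first case.
    ∂X : Fin (suc m) → Carrier
    ∂X Fin.zero    = 0#
    ∂X (Fin.suc l) = s l * ∂ (inject₁ l)

    [∂,X]-term : ∀ i l → [ ∂ i , s l * (x (Fin.suc l) * ∂ (inject₁ l)) ] ≈ δ i (Fin.suc l) * (s l * ∂ (inject₁ l))
    [∂,X]-term i l = begin
      [ ∂ i , s l * (x (Fin.suc l) * ∂ (inject₁ l)) ]
        ≈⟨ [,]-central (s-central l) (∂ i) (x (Fin.suc l) * ∂ (inject₁ l)) ⟩
      s l * [ ∂ i , x (Fin.suc l) * ∂ (inject₁ l) ]
        ≈⟨ *-congˡ ([,]-*ʳ (∂ i) (x (Fin.suc l)) (∂ (inject₁ l))) ⟩
      s l * ([ ∂ i , x (Fin.suc l) ] * ∂ (inject₁ l) + x (Fin.suc l) * [ ∂ i , ∂ (inject₁ l) ])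
        ≈⟨ *-congˡ (+-cong (*-congʳ ([∂,x]≈δ i (Fin.suc l)))
             (trans (*-congˡ ([∂,∂]≈0 i (inject₁ l))) (zeroʳ (x (Fin.suc l))))) ⟩
      s l * (δ i (Fin.suc l) * ∂ (inject₁ l) + 0#)
        ≈⟨ *-congˡ (+-identityʳ (δ i (Fin.suc l) * ∂ (inject₁ l))) ⟩
      s l * (δ i (Fin.suc l) * ∂ (inject₁ l))
        ≈⟨ *-assoc (s l) (δ i (Fin.suc l)) (∂ (inject₁ l)) ⟨
      s l * δ i (Fin.suc l) * ∂ (inject₁ l)
        ≈⟨ *-congʳ (s-central l (δ i (Fin.suc l))) ⟩
      δ i (Fin.suc l) * s l * ∂ (inject₁ l)
        ≈⟨ *-assoc (δ i (Fin.suc l)) (s l) (∂ (inject₁ l)) ⟩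
      δ i (Fin.suc l) * (s l * ∂ (inject₁ l)) ∎

    [∂,X] : ∀ i → [ ∂ i , X ] ≈ ∂X i
    [∂,X] i = begin
      [ ∂ i , X ]
        ≈⟨ [,]-sumʳ (∂ i) (λ l → s l * (x (Fin.suc l) * ∂ (inject₁ l))) ⟩
      sum (λ l → [ ∂ i , s l * (x (Fin.suc l) * ∂ (inject₁ l)) ])
        ≈⟨ sum-cong ([∂,X]-term i) ⟩
      sum (λ l → δ i (Fin.suc l) * (s l * ∂ (inject₁ l)))
        ≈⟨ collapse i ⟩
      ∂X i ∎
      where
      collapse : ∀ i → sum (λ l → δ i (Fin.suc l) * (s l * ∂ (inject₁ l))) ≈ ∂X i
      collapse Fin.zero    = sum-zero (λ l → 0# * (s l * ∂ (inject₁ l))) (λ l → zeroˡ (s l * ∂ (inject₁ l)))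
      collapse (Fin.suc i) = sum-δˡ i (λ l → s l * ∂ (inject₁ l))

    [x,X] : ∀ l → [ x (inject₁ l) , X ] ≈ - (s l * x (Fin.suc l))
    [x,X] l = begin
      [ x (inject₁ l) , X ]
        ≈⟨ [,]-sumʳ (x (inject₁ l)) (λ k → s k * (x (Fin.suc k) * ∂ (inject₁ k))) ⟩
      sum (λ k → [ x (inject₁ l) , s k * (x (Fin.suc k) * ∂ (inject₁ k)) ])
        ≈⟨ sum-cong term ⟩
      sum (λ k → - (s k * x (Fin.suc k) * δ l k))
        ≈⟨ sum-neg (λ k → s k * x (Fin.suc k) * δ l k) ⟩
      - sum (λ k → s k * x (Fin.suc k) * δ l k)
        ≈⟨ -‿cong (sum-δʳ l (λ k → s k * x (Fin.suc k))) ⟩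
      - (s l * x (Fin.suc l)) ∎
      where
      term : ∀ k → [ x (inject₁ l) , s k * (x (Fin.suc k) * ∂ (inject₁ k)) ] ≈ - (s k * x (Fin.suc k) * δ l k)
      term k = begin
        [ x (inject₁ l) , s k * (x (Fin.suc k) * ∂ (inject₁ k)) ]
          ≈⟨ [,]-central (s-central k) (x (inject₁ l)) (x (Fin.suc k) * ∂ (inject₁ k)) ⟩
        s k * [ x (inject₁ l) , x (Fin.suc k) * ∂ (inject₁ k) ]
          ≈⟨ *-congˡ ([,]-*ʳ (x (inject₁ l)) (x (Fin.suc k)) (∂ (inject₁ k))) ⟩
        s k * ([ x (inject₁ l) , x (Fin.suc k) ] * ∂ (inject₁ k) + x (Fin.suc k) * [ x (inject₁ l) , ∂ (inject₁ k) ])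
          ≈⟨ *-congˡ (+-cong (trans (*-congʳ ([x,x]≈0 (inject₁ l) (Fin.suc k))) (zeroˡ (∂ (inject₁ k))))
               (*-congˡ (trans ([,]-antisym (x (inject₁ l)) (∂ (inject₁ k)))
                 (-‿cong (trans ([∂,x]≈δ (inject₁ k) (inject₁ l))
                   (reflexive (≡.trans (δ-inject₁ k l) (δ-sym k l)))))))) ⟩
        s k * (0# + x (Fin.suc k) * - δ l k)
          ≈⟨ *-congˡ (+-identityˡ (x (Fin.suc k) * - δ l k)) ⟩
        s k * (x (Fin.suc k) * - δ l k)
          ≈⟨ *-assoc (s k) (x (Fin.suc k)) (- δ l k) ⟨
        s k * x (Fin.suc k) * - δ l k
          ≈⟨ -‿distribʳ-* (s k * x (Fin.suc k)) (δ l k) ⟨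
        - (s k * x (Fin.suc k) * δ l k) ∎

    -- A single term x_l ∂_(l+1) of `Y` already has a diagonal commutator with the whole of `X`,
    -- which turns ∂_(l+1) into s_l ∂_l and x_l into -s_l x_(l+1). Nothing has to cancel between
    -- different l.
    [Y,X] : [ Y , X ] ≈ sum (λ l → t l * (s l * (x (inject₁ l) * ∂ (inject₁ l) - x (Fin.suc l) * ∂ (Fin.suc l))))
    [Y,X] = begin
      [ Y , X ]
        ≈⟨ [,]-sumˡ (λ l → t l * (x (inject₁ l) * ∂ (Fin.suc l))) X ⟩
      sum (λ l → [ t l * (x (inject₁ l) * ∂ (Fin.suc l)) , X ])
        ≈⟨ sum-cong term ⟩
      sum (λ l → t l * (s l * (x (inject₁ l) * ∂ (inject₁ l) - x (Fin.suc l) * ∂ (Fin.suc l)))) ∎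
      where
      inner : ∀ l → [ x (inject₁ l) * ∂ (Fin.suc l) , X ] ≈
                    s l * (x (inject₁ l) * ∂ (inject₁ l) - x (Fin.suc l) * ∂ (Fin.suc l))
      inner l = begin
        [ x (inject₁ l) * ∂ (Fin.suc l) , X ]
          ≈⟨ [,]-*ˡ (x (inject₁ l)) (∂ (Fin.suc l)) X ⟩
        x (inject₁ l) * [ ∂ (Fin.suc l) , X ] + [ x (inject₁ l) , X ] * ∂ (Fin.suc l)
          ≈⟨ +-cong (*-congˡ ([∂,X] (Fin.suc l))) (*-congʳ ([x,X] l)) ⟩
        x (inject₁ l) * (s l * ∂ (inject₁ l)) + - (s l * x (Fin.suc l)) * ∂ (Fin.suc l)
          ≈⟨ +-cong (sym (*-assoc (x (inject₁ l)) (s l) (∂ (inject₁ l))))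
                    (sym (-‿distribˡ-* (s l * x (Fin.suc l)) (∂ (Fin.suc l)))) ⟩
        x (inject₁ l) * s l * ∂ (inject₁ l) - s l * x (Fin.suc l) * ∂ (Fin.suc l)
          ≈⟨ +-cong (trans (*-congʳ (sym (s-central l (x (inject₁ l))))) (*-assoc (s l) (x (inject₁ l)) (∂ (inject₁ l))))
                    (trans (-‿cong (*-assoc (s l) (x (Fin.suc l)) (∂ (Fin.suc l))))
                      (-‿distribʳ-* (s l) (x (Fin.suc l) * ∂ (Fin.suc l)))) ⟩
        s l * (x (inject₁ l) * ∂ (inject₁ l)) + s l * - (x (Fin.suc l) * ∂ (Fin.suc l))
          ≈⟨ distribˡ (s l) (x (inject₁ l) * ∂ (inject₁ l)) (- (x (Fin.suc l) * ∂ (Fin.suc l))) ⟨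
        s l * (x (inject₁ l) * ∂ (inject₁ l) - x (Fin.suc l) * ∂ (Fin.suc l)) ∎
      term : ∀ l → [ t l * (x (inject₁ l) * ∂ (Fin.suc l)) , X ] ≈
                   t l * (s l * (x (inject₁ l) * ∂ (inject₁ l) - x (Fin.suc l) * ∂ (Fin.suc l)))
      term l = begin
        [ t l * (x (inject₁ l) * ∂ (Fin.suc l)) , X ]
          ≈⟨ [,]-antisym (t l * (x (inject₁ l) * ∂ (Fin.suc l))) X ⟩
        - [ X , t l * (x (inject₁ l) * ∂ (Fin.suc l)) ]
          ≈⟨ -‿cong ([,]-central (t-central l) X (x (inject₁ l) * ∂ (Fin.suc l))) ⟩
        - (t l * [ X , x (inject₁ l) * ∂ (Fin.suc l) ])
          ≈⟨ -‿distribʳ-* (t l) [ X , x (inject₁ l) * ∂ (Fin.suc l) ] ⟩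
        t l * - [ X , x (inject₁ l) * ∂ (Fin.suc l) ]
          ≈⟨ *-congˡ ([,]-antisym (x (inject₁ l) * ∂ (Fin.suc l)) X) ⟨
        t l * [ x (inject₁ l) * ∂ (Fin.suc l) , X ]
          ≈⟨ *-congˡ (inner l) ⟩
        t l * (s l * (x (inject₁ l) * ∂ (inject₁ l) - x (Fin.suc l) * ∂ (Fin.suc l))) ∎

    -- The Leibniz rule leaves commutators with ∂_i and with its opposite; reversing the order of
    -- one of the sums makes both depend on [∂_i, a] alone.
    [Δ,-] : ∀ a → [ Δ , a ] ≈ sum (λ i → ∂ (opposite i) * [ ∂ i , a ]) + sum (λ i → [ ∂ i , a ] * ∂ (opposite i))
    [Δ,-] a = begin
      [ Δ , a ]
        ≈⟨ [,]-sumˡ (λ i → ∂ i * ∂ (opposite i)) a ⟩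
      sum (λ i → [ ∂ i * ∂ (opposite i) , a ])
        ≈⟨ sum-cong (λ i → [,]-*ˡ (∂ i) (∂ (opposite i)) a) ⟩
      sum (λ i → ∂ i * [ ∂ (opposite i) , a ] + [ ∂ i , a ] * ∂ (opposite i))
        ≈⟨ ∑-distrib-+ (λ i → ∂ i * [ ∂ (opposite i) , a ]) (λ i → [ ∂ i , a ] * ∂ (opposite i)) ⟩
      sum (λ i → ∂ i * [ ∂ (opposite i) , a ]) + sum (λ i → [ ∂ i , a ] * ∂ (opposite i))
        ≈⟨ +-congʳ (trans
             (sum-cong λ i → reflexive
               (cong (λ j → ∂ j * [ ∂ (opposite i) , a ]) (≡.sym (Finₚ.opposite-involutive i))))
             (sum-opposite (λ i → ∂ (opposite i) * [ ∂ i , a ]))) ⟩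
      sum (λ i → ∂ (opposite i) * [ ∂ i , a ]) + sum (λ i → [ ∂ i , a ] * ∂ (opposite i)) ∎

    [Δ,X]≈0 : [ Δ , X ] ≈ 0#
    [Δ,X]≈0 = begin
      [ Δ , X ]
        ≈⟨ [Δ,-] X ⟩
      sum (λ i → ∂ (opposite i) * [ ∂ i , X ]) + sum (λ i → [ ∂ i , X ] * ∂ (opposite i))
        ≈⟨ +-cong (sum-cong λ i → *-congˡ {∂ (opposite i)} ([∂,X] i))
                  (sum-cong λ i → *-congʳ {∂ (opposite i)} ([∂,X] i)) ⟩
      (∂ (opposite Fin.zero) * 0# + sum (λ l → ∂ (inject₁ (opposite l)) * (s l * ∂ (inject₁ l)))) +
      (0# * ∂ (opposite Fin.zero) + sum (λ l → (s l * ∂ (inject₁ l)) * ∂ (inject₁ (opposite l))))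
        ≈⟨ +-cong (trans (+-congʳ (zeroʳ _)) (+-identityˡ _)) (trans (+-congʳ (zeroˡ _)) (+-identityˡ _)) ⟩
      sum (λ l → ∂ (inject₁ (opposite l)) * (s l * ∂ (inject₁ l))) +
      sum (λ l → (s l * ∂ (inject₁ l)) * ∂ (inject₁ (opposite l)))
        ≈⟨ +-cong (sum-cong reorder) (sum-cong λ l → *-assoc (s l) (∂ (inject₁ l)) (∂ (inject₁ (opposite l)))) ⟩
      S + S
        -- The reversal l ↦ m - 1 - l exchanges two commuting derivatives and negates the sign, so S
        -- = -S. Replacing just one of the two copies of S gives 0 in any ring, without cancelling a
        -- 2.
        ≈⟨ +-congʳ S≈-S ⟩
      - S + S
        ≈⟨ -‿inverseˡ S ⟩
      0# ∎
      where
      term : Fin m → Carrier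
      term l = s l * (∂ (inject₁ l) * ∂ (inject₁ (opposite l)))
      S = sum term
      reorder : ∀ l → ∂ (inject₁ (opposite l)) * (s l * ∂ (inject₁ l)) ≈ term l
      reorder l = begin
        ∂ (inject₁ (opposite l)) * (s l * ∂ (inject₁ l))    ≈⟨ *-assoc _ (s l) _ ⟨
        ∂ (inject₁ (opposite l)) * s l * ∂ (inject₁ l)      ≈⟨ *-congʳ (s-central l _) ⟨
        s l * ∂ (inject₁ (opposite l)) * ∂ (inject₁ l)      ≈⟨ *-assoc (s l) _ _ ⟩
        s l * (∂ (inject₁ (opposite l)) * ∂ (inject₁ l))    ≈⟨ *-congˡ (∂-comm _ _) ⟩
        term l ∎
      S≈-S : S ≈ - S
      S≈-S = begin
        S                                ≈⟨ sum-opposite term ⟨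
        sum (term ∘ opposite)            ≈⟨ sum-cong (λ l → begin
          s (opposite l) * (∂ (inject₁ (opposite l)) * ∂ (inject₁ (opposite (opposite l))))
            ≈⟨ *-congʳ (s-odd l) ⟩
          - s l * (∂ (inject₁ (opposite l)) * ∂ (inject₁ (opposite (opposite l))))
            ≡⟨ cong (λ i → - s l * (∂ (inject₁ (opposite l)) * ∂ (inject₁ i))) (Finₚ.opposite-involutive l) ⟩
          - s l * (∂ (inject₁ (opposite l)) * ∂ (inject₁ l))
            ≈⟨ *-congˡ (∂-comm _ _) ⟩
          - s l * (∂ (inject₁ l) * ∂ (inject₁ (opposite l)))
            ≈⟨ -‿distribˡ-* (s l) _ ⟨
          - term l ∎) ⟩
        sum (λ l → - term l)             ≈⟨ sum-neg term ⟩
        - S                              ∎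

    [∂,Q] : ∀ i → [ ∂ i , Q ] ≈ x (opposite i) + x (opposite i)
    [∂,Q] i = begin
      [ ∂ i , Q ]
        ≈⟨ [,]-sumʳ (∂ i) (λ j → x j * x (opposite j)) ⟩
      sum (λ j → [ ∂ i , x j * x (opposite j) ])
        ≈⟨ sum-cong (λ j → trans ([,]-*ʳ (∂ i) (x j) (x (opposite j)))
             (+-cong (*-congʳ ([∂,x]≈δ i j)) (*-congˡ ([∂,x]≈δ i (opposite j))))) ⟩
      sum (λ j → δ i j * x (opposite j) + x j * δ i (opposite j))
        ≈⟨ ∑-distrib-+ (λ j → δ i j * x (opposite j)) (λ j → x j * δ i (opposite j)) ⟩
      sum (λ j → δ i j * x (opposite j)) + sum (λ j → x j * δ i (opposite j))
        ≈⟨ +-congˡ (trans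
             (sum-cong λ j → reflexive
               (cong (λ k → x k * δ i (opposite j)) (≡.sym (Finₚ.opposite-involutive j))))
             (sum-opposite (λ j → x (opposite j) * δ i j))) ⟩
      sum (λ j → δ i j * x (opposite j)) + sum (λ j → x (opposite j) * δ i j)
        ≈⟨ +-cong (sum-δˡ i (x ∘ opposite)) (sum-δʳ i (x ∘ opposite)) ⟩
      x (opposite i) + x (opposite i) ∎

    -- With the Euler operator E, the sum of all `N i`, this is 4E + 2(m + 1): a positive number on
    -- each homogeneous piece.
    [Δ,Q] : let N = λ i → x i * ∂ i in
            [ Δ , Q ] ≈ sum (λ i → (N i + 1#) + (N i + 1#)) + sum (λ i → N i + N i)
    [Δ,Q] = begin
      [ Δ , Q ]
        ≈⟨ [Δ,-] Q ⟩
      sum (λ i → ∂ (opposite i) * [ ∂ i , Q ]) + sum (λ i → [ ∂ i , Q ] * ∂ (opposite i))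
        ≈⟨ +-cong (sum-cong λ i → *-congˡ {∂ (opposite i)} ([∂,Q] i))
                  (sum-cong λ i → *-congʳ {∂ (opposite i)} ([∂,Q] i)) ⟩
      sum (λ i → ∂ (opposite i) * (x (opposite i) + x (opposite i))) +
      sum (λ i → (x (opposite i) + x (opposite i)) * ∂ (opposite i))
        ≈⟨ +-cong (sum-opposite (λ i → ∂ i * (x i + x i))) (sum-opposite (λ i → (x i + x i) * ∂ i)) ⟩
      sum (λ i → ∂ i * (x i + x i)) + sum (λ i → (x i + x i) * ∂ i)
        ≈⟨ +-cong (sum-cong λ i → trans (distribˡ (∂ i) (x i) (x i)) (+-cong (∂x i) (∂x i)))
                  (sum-cong λ i → distribʳ (∂ i) (x i) (x i)) ⟩
      sum (λ i → (x i * ∂ i + 1#) + (x i * ∂ i + 1#)) + sum (λ i → x i * ∂ i + x i * ∂ i) ∎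
      where
      ∂x : ∀ i → ∂ i * x i ≈ x i * ∂ i + 1#
      ∂x i = trans (∂-x i i) (+-congˡ (reflexive (δ-refl i)))
        where
        δ-refl : ∀ {n} (i : Fin n) → δ i i ≡ 1#
        δ-refl Fin.zero    = refl
        δ-refl (Fin.suc i) = δ-refl i

open import Defs
open import Algebra.Properties.CommutativeSemigroup using (interchange)
open import Data.Integer.Base as ℤ using (ℤ; 0ℤ; 1ℤ)
import Data.Integer.Properties as ℤₚ
open import Data.Integer.Tactic.RingSolver using (solve-∀)
open import Data.List.Base as List using (List; []; _∷_; _++_; length; lookup)
open import Data.List.Membership.Propositional using (_∈_; _∉_)
open import Data.List.Membership.Propositional.Properties using (∈-map⁺; ∈-map⁻; ∈-++⁺ˡ; ∈-++⁺ʳ; ∈-++⁻)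
import Data.List.Properties as Listₚ
import Data.List.Relation.Unary.All as All
open import Data.List.Relation.Unary.AllPairs using ([]; _∷_)
open import Data.List.Relation.Unary.Any using (here; there; index)
open import Data.List.Relation.Unary.Any.Properties using (lookup-index)
open import Data.List.Relation.Unary.Unique.Propositional using (Unique)
import Data.List.Relation.Unary.Unique.Propositional.Properties as Uniqueₚ
open import Data.Nat.Base using (_+_; _*_; _∸_; _≤_; _<_; ⌊_/2⌋; NonZero; s≤s; z≤n)
open import Data.Nat.Divisibility using (_∣_; divides)
import Data.Nat.Properties as ℕₚ
import Data.Nat.Tactic.RingSolver as ℕSolver
open import Data.Product.Base using (_×_; _,_; proj₁; proj₂; ∃-syntax)
open import Data.Sum.Base using (_⊎_; inj₁; inj₂; [_,_]′)
import Data.Sum.Properties as Sumₚ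
open import Data.Vec.Base as Vec using (Vec; []; _∷_; updateAt)
import Data.Vec.Properties as Vecₚ
open import Level using (0ℓ)
open import Relation.Binary.Definitions using (DecidableEquality)
open import Relation.Binary.PropositionalEquality
open import Relation.Nullary.Decidable using (¬?; decidable-stable; dec-true; dec-false; _×-dec_)

open Algebra.Properties.Semiring.Sum ℤₚ.+-*-semiring using () renaming (sum to ∑)
module ∑ = Algebra.Properties.Semiring.Sum ℤₚ.+-*-semiring

-- The semiring of power series

infixl 6 _⊕_

_⊕_ : Series → Series → Series
(f ⊕ g) k = f k ℤ.+ g k

𝟘 : Series
𝟘 _ = 0ℤ

-- By computation alone, the coefficient of q^(k+1) in `f ⊛ g` is f(0) g(k+1) plus the coefficient
-- of q^k in `f ∘ suc ⊛ g`. Most laws below are inductions along this recursion, with the left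
-- factor generalised.
⊛-cong : ∀ {f f′ g g′} → f ≗ f′ → g ≗ g′ → f ⊛ g ≗ f′ ⊛ g′
⊛-cong f≗ g≗ zero    = cong (ℤ._+ 0ℤ) (cong₂ ℤ._*_ (f≗ 0) (g≗ 0))
⊛-cong f≗ g≗ (suc k) = cong₂ ℤ._+_ (cong₂ ℤ._*_ (f≗ 0) (g≗ (suc k))) (⊛-cong (f≗ ∘ suc) g≗ k)

⊛-zeroˡ : ∀ f → 𝟘 ⊛ f ≗ 𝟘
⊛-zeroˡ f zero    = refl
⊛-zeroˡ f (suc k) = trans (ℤₚ.+-identityˡ _) (⊛-zeroˡ f k)

⊛-identityˡ : ∀ f → q^ 0 ⊛ f ≗ f
⊛-identityˡ f zero    = trans (ℤₚ.+-identityʳ _) (ℤₚ.*-identityˡ _)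
⊛-identityˡ f (suc k) = trans
  (cong₂ ℤ._+_ (ℤₚ.*-identityˡ (f (suc k))) (⊛-zeroˡ f k)) (ℤₚ.+-identityʳ _)

⊛-distribʳ-⊕ : ∀ h f g → (f ⊕ g) ⊛ h ≗ f ⊛ h ⊕ g ⊛ h
⊛-distribʳ-⊕ h f g zero    = lemma (f 0) (g 0) (h 0)
  where
  lemma : ∀ a b c → (a ℤ.+ b) ℤ.* c ℤ.+ 0ℤ ≡ (a ℤ.* c ℤ.+ 0ℤ) ℤ.+ (b ℤ.* c ℤ.+ 0ℤ)
  lemma = solve-∀
⊛-distribʳ-⊕ h f g (suc k) = trans
  (cong (λ t → (f ⊕ g) 0 ℤ.* h (suc k) ℤ.+ t) (⊛-distribʳ-⊕ h (f ∘ suc) (g ∘ suc) k))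
  (lemma (f 0) (g 0) (h (suc k)) ((f ∘ suc ⊛ h) k) ((g ∘ suc ⊛ h) k))
  where
  lemma : ∀ a b c d e → (a ℤ.+ b) ℤ.* c ℤ.+ (d ℤ.+ e) ≡ (a ℤ.* c ℤ.+ d) ℤ.+ (b ℤ.* c ℤ.+ e)
  lemma = solve-∀

⊛-scaleˡ : ∀ c f g k → ((λ j → c ℤ.* f j) ⊛ g) k ≡ c ℤ.* (f ⊛ g) k
⊛-scaleˡ c f g zero    = lemma c (f 0) (g 0)
  where
  lemma : ∀ c a b → (c ℤ.* a) ℤ.* b ℤ.+ 0ℤ ≡ c ℤ.* (a ℤ.* b ℤ.+ 0ℤ)
  lemma = solve-∀
⊛-scaleˡ c f g (suc k) = trans
  (cong (λ t → c ℤ.* f 0 ℤ.* g (suc k) ℤ.+ t) (⊛-scaleˡ c (f ∘ suc) g k))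
  (lemma c (f 0) (g (suc k)) ((f ∘ suc ⊛ g) k))
  where
  lemma : ∀ c a b d → (c ℤ.* a) ℤ.* b ℤ.+ c ℤ.* d ≡ c ℤ.* (a ℤ.* b ℤ.+ d)
  lemma = solve-∀

-- The mirror image of the defining recursion: here the constant term of the right factor is split
-- off. Comparing the two recursions gives commutativity.
⊛-sucʳ : ∀ f g k → (f ⊛ g) (suc k) ≡ (f ⊛ g ∘ suc) k ℤ.+ f (suc k) ℤ.* g 0
⊛-sucʳ f g zero    = lemma (f 0) (g 1) (f 1) (g 0)
  where
  lemma : ∀ a b c d → a ℤ.* b ℤ.+ (c ℤ.* d ℤ.+ 0ℤ) ≡ (a ℤ.* b ℤ.+ 0ℤ) ℤ.+ c ℤ.* d
  lemma = solve-∀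
⊛-sucʳ f g (suc k) = trans
  (cong (λ t → f 0 ℤ.* g (suc (suc k)) ℤ.+ t) (⊛-sucʳ (f ∘ suc) g k))
  (sym (ℤₚ.+-assoc (f 0 ℤ.* g (suc (suc k))) _ _))

⊛-comm : ∀ f g → f ⊛ g ≗ g ⊛ f
⊛-comm f g zero    = cong (ℤ._+ 0ℤ) (ℤₚ.*-comm (f 0) (g 0))
⊛-comm f g (suc k) = trans (⊛-sucʳ f g k) (trans
  (cong₂ ℤ._+_ (⊛-comm f (g ∘ suc) k) (ℤₚ.*-comm (f (suc k)) (g 0)))
  (ℤₚ.+-comm ((g ∘ suc ⊛ f) k) _))

⊛-assoc : ∀ f g h → (f ⊛ g) ⊛ h ≗ f ⊛ (g ⊛ h)
⊛-assoc f g h zero = lemma (f 0) (g 0) (h 0)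
  where
  lemma : ∀ a b c → (a ℤ.* b ℤ.+ 0ℤ) ℤ.* c ℤ.+ 0ℤ ≡ a ℤ.* (b ℤ.* c ℤ.+ 0ℤ) ℤ.+ 0ℤ
  lemma = solve-∀
⊛-assoc f g h (suc k) = trans
  (cong (λ t → (f ⊛ g) 0 ℤ.* h (suc k) ℤ.+ t) (trans
    (⊛-distribʳ-⊕ h (λ j → f 0 ℤ.* g (suc j)) (f ∘ suc ⊛ g) k)
    (cong₂ ℤ._+_ (⊛-scaleˡ (f 0) (g ∘ suc) h k) (⊛-assoc (f ∘ suc) g h k))))
  (lemma (f 0) (g 0) (h (suc k)) ((g ∘ suc ⊛ h) k) ((f ∘ suc ⊛ (g ⊛ h)) k))
  where
  lemma : ∀ a b c d e → (a ℤ.* b ℤ.+ 0ℤ) ℤ.* c ℤ.+ (a ℤ.* d ℤ.+ e) ≡ a ℤ.* (b ℤ.* c ℤ.+ d) ℤ.+ e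
  lemma = solve-∀

⊛-distribˡ-⊕ : ∀ h f g → h ⊛ (f ⊕ g) ≗ h ⊛ f ⊕ h ⊛ g
⊛-distribˡ-⊕ h f g k = trans (⊛-comm h (f ⊕ g) k) (trans (⊛-distribʳ-⊕ h f g k)
  (cong₂ ℤ._+_ (⊛-comm f h k) (⊛-comm g h k)))

-- Wrapping the pointwise equality in a record lets the two sides be inferred.
infix 4 _≈_
record _≈_ (f g : Series) : Set where
  constructor pointwise
  field at : f ≗ g
open _≈_

⊕-⊛-commutativeSemiring : CommutativeSemiring 0ℓ 0ℓ
⊕-⊛-commutativeSemiring = record
  { Carrier = Series ; _≈_ = _≈_ ; _+_ = _⊕_ ; _*_ = _⊛_ ; 0# = 𝟘 ; 1# = q^ 0
  ; isCommutativeSemiring = record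
    { isSemiring = record
      { isSemiringWithoutAnnihilatingZero = record
        { +-isCommutativeMonoid = record
          { isMonoid = record
            { isSemigroup = record
              { isMagma = record
                { isEquivalence = record
                  { refl  = pointwise λ _ → refl
                  ; sym   = λ e → pointwise λ k → sym (e .at k)
                  ; trans = λ e e′ → pointwise λ k → trans (e .at k) (e′ .at k)
                  }
                ; ∙-cong = λ e e′ → pointwise λ k → cong₂ ℤ._+_ (e .at k) (e′ .at k)
                }
              ; assoc = λ f g h → pointwise λ k → ℤₚ.+-assoc (f k) (g k) (h k)
              }
            ; identity = (λ f → pointwise λ k → ℤₚ.+-identityˡ (f k)) , (λ f → pointwise λ k → ℤₚ.+-identityʳ (f k))
            }
          ; comm = λ f g → pointwise λ k → ℤₚ.+-comm (f k) (g k)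
          }
        ; *-cong     = λ e e′ → pointwise (⊛-cong (e .at) (e′ .at))
        ; *-assoc    = λ f g h → pointwise (⊛-assoc f g h)
        ; *-identity = (λ f → pointwise (⊛-identityˡ f))
                     , λ f → pointwise λ k → trans (⊛-comm f (q^ 0) k) (⊛-identityˡ f k)
        ; distrib    = (λ h f g → pointwise (⊛-distribˡ-⊕ h f g)) , λ h f g → pointwise (⊛-distribʳ-⊕ h f g)
        }
      ; zero = (λ f → pointwise (⊛-zeroˡ f)) , λ f → pointwise λ k → trans (⊛-comm f 𝟘 k) (⊛-zeroˡ f k)
      }
    ; *-comm = λ f g → pointwise (⊛-comm f g)
    }
  }

open CommutativeSemiring ⊕-⊛-commutativeSemiring public using () renaming
  ( setoid to seriesSetoid; refl to ≈-refl; sym to ≈-sym; trans to ≈-trans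
  ; +-cong to ⊕-cong; +-congˡ to ⊕-congˡ; +-congʳ to ⊕-congʳ
  ; *-congˡ to ⊛-congˡ; *-congʳ to ⊛-congʳ; *-identityˡ to ⊛-identityˡ-≈; zeroʳ to ⊛-zeroʳ-≈; *-assoc to ⊛-assoc-≈)
open import Algebra.Solver.Ring.NaturalCoefficients.Default ⊕-⊛-commutativeSemiring
  using (solve; _:=_; _:+_; _:*_)
module ≈-Reasoning = Relation.Binary.Reasoning.Setoid seriesSetoid

-- Powers of q and quotients of the polynomials 1 - q^k

q^-assoc : ∀ a b f → q^ (a + b) ⊛ f ≈ q^ a ⊛ (q^ b ⊛ f)
q^-assoc a b f = pointwise (go a)
  where
  go : ∀ a k → (q^ (a + b) ⊛ f) k ≡ (q^ a ⊛ (q^ b ⊛ f)) k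
  go zero    k       = sym (⊛-identityˡ (q^ b ⊛ f) k)
  go (suc a) zero    = refl
  go (suc a) (suc k) = cong (λ t → 0ℤ ℤ.+ t) (go a k)

q^⊛1-q^ : ∀ a b k → (q^ a ⊛ 1-q^ b) k ≡ (q^ a) k ℤ.- (q^ (a + b)) k
q^⊛1-q^ zero    b k       = ⊛-identityˡ (1-q^ b) k
q^⊛1-q^ (suc a) b zero    = refl
q^⊛1-q^ (suc a) b (suc k) = trans (ℤₚ.+-identityˡ _) (q^⊛1-q^ a b k)

1-q^-+ : ∀ a b → 1-q^ (a + b) ≈ 1-q^ a ⊕ q^ a ⊛ 1-q^ b
1-q^-+ a b = pointwise λ k → trans
  (lemma ((q^ 0) k) ((q^ a) k) ((q^ (a + b)) k))
  (cong (λ t → (1-q^ a) k ℤ.+ t) (sym (q^⊛1-q^ a b k)))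
  where
  lemma : ∀ x y z → x ℤ.- z ≡ (x ℤ.- y) ℤ.+ (y ℤ.- z)
  lemma = solve-∀

1-q^-+-⊛ : ∀ a b f → 1-q^ (a + b) ⊛ f ≈ 1-q^ a ⊛ f ⊕ q^ a ⊛ (1-q^ b ⊛ f)
1-q^-+-⊛ a b f = ≈-trans (⊛-congʳ (1-q^-+ a b))
  (solve 4 (λ x y z w → (x :+ y :* z) :* w := x :* w :+ y :* (z :* w)) ≈-refl
    (1-q^ a) (q^ a) (1-q^ b) f)

-- Cross-multiplication: the quotients below are evaluated in this way, from identities with cleared
-- denominators.
ratio-⊛ : ∀ a b .{{_ : NonZero b}} {f g} → 1-q^ a ⊛ f ≈ 1-q^ b ⊛ g → ratio a b ⊛ f ≈ g
ratio-⊛ a b {f} {g} e = begin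
  1-q^ a ⊛ 1/1-q^ b ⊛ f    ≈⟨ swap (1-q^ a) (1/1-q^ b) f ⟩
  1-q^ a ⊛ f ⊛ 1/1-q^ b    ≈⟨ ⊛-congʳ e ⟩
  1-q^ b ⊛ g ⊛ 1/1-q^ b    ≈⟨ swap (1-q^ b) g (1/1-q^ b) ⟩
  1-q^ b ⊛ 1/1-q^ b ⊛ g    ≈⟨ ⊛-congʳ (pointwise (1-q^-inverse b)) ⟩
  q^ 0 ⊛ g                 ≈⟨ ⊛-identityˡ-≈ g ⟩
  g                        ∎
  where
  open ≈-Reasoning
  swap : ∀ x y z → x ⊛ y ⊛ z ≈ x ⊛ z ⊛ y
  swap = solve 3 (λ x y z → x :* y :* z := x :* z :* y) ≈-refl

1-q^-cancel : ∀ a .{{_ : NonZero a}} {f g} → 1-q^ a ⊛ f ≈ 1-q^ a ⊛ g → f ≈ g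
1-q^-cancel a {f} {g} e = ≈-trans (≈-sym (ratio-⊛ a a ≈-refl)) (ratio-⊛ a a e)

q^⊛-+ : ∀ a f j → (q^ a ⊛ f) (a + j) ≡ f j
q^⊛-+ zero    f j = ⊛-identityˡ f j
q^⊛-+ (suc a) f j = trans (ℤₚ.+-identityˡ _) (q^⊛-+ a f j)

q^⊛-< : ∀ {a j} f → j < a → (q^ a ⊛ f) j ≡ 0ℤ
q^⊛-< {suc a} {zero}  f _         = refl
q^⊛-< {suc a} {suc j} f (s≤s j<a) = trans (ℤₚ.+-identityˡ _) (q^⊛-< f j<a)

-- Counting monomials

-- Exponent vectors v = (a₀, …, a_{n-1}) of monomials in x₀, …, x_{n-1}, where x_i has weight i.

degree weight : ∀ {n} → Vec ℕ n → ℕ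
degree []      = 0
degree (a ∷ v) = a + degree v
weight []      = 0
weight (a ∷ v) = degree v + weight v

shift : ∀ {A : Set} → ℕ → (ℕ → List A) → ℕ → List A
shift zero    f j       = f j
shift (suc a) f zero    = []
shift (suc a) f (suc j) = shift a f j

suc-head : ∀ {n} → Vec ℕ (suc n) → Vec ℕ (suc n)
suc-head (a ∷ v) = suc a ∷ v

-- A monomial of positive degree either contains x_0, which can be divided out without changing the
-- weight, or lives in the later variables, whose renumbering lowers the weight by the degree.
-- Counting these two cases is the first Pascal rule.
exponents : ∀ n → ℕ → ℕ → List (Vec ℕ n)
exponents zero    zero    zero    = [] ∷ []
exponents zero    zero    (suc j) = []
exponents zero    (suc k) j       = []
exponents (suc n) zero    j       = List.map (0 ∷_) (exponents n zero j)
exponents (suc n) (suc k) j       =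
  List.map suc-head (exponents (suc n) k j) ++ List.map (0 ∷_) (shift (suc k) (exponents n (suc k)) j)

∈-shift⁺ : ∀ {A : Set} {x : A} a {f j} → x ∈ f j → x ∈ shift a f (a + j)
∈-shift⁺ zero    x∈ = x∈
∈-shift⁺ (suc a) x∈ = ∈-shift⁺ a x∈

∈-shift⁻ : ∀ {A : Set} {x : A} a {f j} → x ∈ shift a f j → ∃[ i ] a + i ≡ j × x ∈ f i
∈-shift⁻ zero    {j = j}     x∈ = j , refl , x∈
∈-shift⁻ (suc a) {j = suc j} x∈ with ∈-shift⁻ a x∈
... | i , refl , x∈′ = i , refl , x∈′

shift-unique : ∀ {A : Set} a {f : ℕ → List A} j → (∀ i → Unique (f i)) → Unique (shift a f j)
shift-unique zero    j       u = u j
shift-unique (suc a) zero    u = []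
shift-unique (suc a) (suc j) u = shift-unique a j u

exponents-sound : ∀ n k j {v} → v ∈ exponents n k j → degree v ≡ k × weight v ≡ j
exponents-sound zero zero zero (here refl) = refl , refl
exponents-sound (suc n) zero j v∈ with ∈-map⁻ (0 ∷_) v∈
... | u , u∈ , refl with exponents-sound n zero j u∈
...   | d , w = d , trans (cong (_+ weight u) d) w
exponents-sound (suc n) (suc k) j v∈ with ∈-++⁻ (List.map suc-head (exponents (suc n) k j)) v∈
... | inj₁ v∈ˡ with ∈-map⁻ suc-head v∈ˡ
...   | (a ∷ u) , u∈ , refl with exponents-sound (suc n) k j u∈
...     | d , w = cong suc d , w
exponents-sound (suc n) (suc k) j v∈ | inj₂ v∈ʳ with ∈-map⁻ (0 ∷_) v∈ʳ
...   | u , u∈ , refl with ∈-shift⁻ (suc k) {exponents n (suc k)} {j} u∈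
...     | i , refl , u∈′ with exponents-sound n (suc k) i u∈′
...       | d , w = d , cong₂ _+_ d w

exponents-complete : ∀ {n} (v : Vec ℕ n) → v ∈ exponents n (degree v) (weight v)
exponents-complete [] = here refl
exponents-complete {suc n} (a ∷ v) = go a
  where
  go₀ : ∀ k → v ∈ exponents n k (weight v) → (0 ∷ v) ∈ exponents (suc n) k (k + weight v)
  go₀ zero    v∈ = ∈-map⁺ (0 ∷_) v∈
  go₀ (suc k) v∈ = ∈-++⁺ʳ (List.map suc-head (exponents (suc n) k (suc k + weight v)))
                     (∈-map⁺ (0 ∷_) (∈-shift⁺ (suc k) v∈))
  go : ∀ a → (a ∷ v) ∈ exponents (suc n) (a + degree v) (degree v + weight v)
  go zero    = go₀ (degree v) (exponents-complete v)
  go (suc a) = ∈-++⁺ˡ (∈-map⁺ suc-head (go a))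

exponents-unique : ∀ n k j → Unique (exponents n k j)
exponents-unique zero    zero    zero    = All.[] ∷ []
exponents-unique zero    zero    (suc j) = []
exponents-unique zero    (suc k) j       = []
exponents-unique (suc n) zero    j       = Uniqueₚ.map⁺ (λ { refl → refl }) (exponents-unique n zero j)
exponents-unique (suc n) (suc k) j       = Uniqueₚ.++⁺
  (Uniqueₚ.map⁺ suc-head-injective (exponents-unique (suc n) k j))
  (Uniqueₚ.map⁺ (λ { refl → refl }) (shift-unique (suc k) j (exponents-unique n (suc k))))
  λ { (v∈ˡ , v∈ʳ) → disjoint (∈-map⁻ suc-head v∈ˡ) (∈-map⁻ (0 ∷_) v∈ʳ) }
  where
  suc-head-injective : ∀ {u v : Vec ℕ (suc n)} → suc-head u ≡ suc-head v → u ≡ v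
  suc-head-injective {a ∷ u} {.a ∷ .u} refl = refl
  disjoint : ∀ {v : Vec ℕ (suc n)} {X : Vec ℕ (suc n) → Set} {Z : Vec ℕ n → Set} → 
             (∃[ u ] X u × v ≡ suc-head u) → ¬ (∃[ u ] Z u × v ≡ 0 ∷ u)
  disjoint ((_ ∷ _) , _ , refl) (_ , _ , ())

-- The complete homogeneous symmetric polynomial h_k at 1, q, ..., q^(n-1), which for n > 0 is the
-- Gaussian polynomial [n+k-1,k].
homogeneous : ℕ → ℕ → Series
homogeneous n k j = ℤ.+ length (exponents n k j)

length-shift : ∀ {A : Set} a (f : ℕ → List A) j →
               ℤ.+ length (shift a f j) ≡ (q^ a ⊛ λ i → ℤ.+ length (f i)) j
length-shift zero    f j       = sym (⊛-identityˡ (λ i → ℤ.+ length (f i)) j)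
length-shift (suc a) f zero    = refl
length-shift (suc a) f (suc j) = trans (length-shift a f j) (sym (ℤₚ.+-identityˡ _))

-- Pascal's rules and Gaussian polynomials

≡⇒≈ : ∀ {f g} → f ≡ g → f ≈ g
≡⇒≈ refl = ≈-refl

homogeneous-zero : ∀ n → homogeneous (suc n) 0 ≈ homogeneous n 0
homogeneous-zero n = pointwise λ j → cong ℤ.+_ (Listₚ.length-map (0 ∷_) (exponents n 0 j))

homogeneous-zeroᵈ : ∀ n → homogeneous n 0 ≗ q^ 0
homogeneous-zeroᵈ zero    zero    = refl
homogeneous-zeroᵈ zero    (suc j) = refl
homogeneous-zeroᵈ (suc n) j       = trans (homogeneous-zero n .at j) (homogeneous-zeroᵈ n j)

pascal : ∀ n k → homogeneous (suc n) (suc k) ≈ homogeneous (suc n) k ⊕ q^ suc k ⊛ homogeneous n (suc k)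
pascal n k = pointwise λ j → trans
  (cong ℤ.+_ (trans
    (Listₚ.length-++ (List.map suc-head (exponents (suc n) k j)))
    (cong₂ _+_ (Listₚ.length-map suc-head (exponents (suc n) k j))
               (Listₚ.length-map (0 ∷_) (shift (suc k) (exponents n (suc k)) j)))))
  (cong (λ t → homogeneous (suc n) k j ℤ.+ t) (length-shift (suc k) (exponents n (suc k)) j))

-- The two quotients of neighbouring Gaussian polynomials, with denominators cleared. They need a
-- joint induction: after Pascal's rule the two induction hypotheses share their right-hand side,
-- which allows one left-hand side to be traded for the other.
raise-degree : ∀ n k → 1-q^ suc k ⊛ homogeneous n (suc k) ≈ 1-q^ (k + n) ⊛ homogeneous n k
raise-vars   : ∀ n k → 1-q^ n ⊛ homogeneous (suc n) k ≈ 1-q^ (k + n) ⊛ homogeneous n k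

raise-degree zero    zero    = ≈-trans (⊛-zeroʳ-≈ (1-q^ 1)) (≈-sym (≈-trans
  (⊛-congʳ {homogeneous 0 0} {1-q^ 0} {𝟘} (pointwise λ j → ℤₚ.+-inverseʳ ((q^ 0) j)))
  (pointwise (⊛-zeroˡ (homogeneous 0 0)))))
raise-degree zero    (suc k) = ≈-trans (⊛-zeroʳ-≈ (1-q^ suc (suc k))) (≈-sym (⊛-zeroʳ-≈ (1-q^ (suc k + 0))))
raise-degree (suc n) k       = begin
  1-q^ suc k ⊛ homogeneous (suc n) (suc k)
    ≈⟨ ⊛-congˡ {1-q^ suc k} (pascal n k) ⟩
  1-q^ suc k ⊛ (homogeneous (suc n) k ⊕ q^ suc k ⊛ homogeneous n (suc k))
    ≈⟨ solve 4 (λ a b c d → a :* (b :+ c :* d) := a :* b :+ c :* (a :* d)) ≈-refl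
         (1-q^ suc k) (homogeneous (suc n) k) (q^ suc k) (homogeneous n (suc k)) ⟩
  1-q^ suc k ⊛ homogeneous (suc n) k ⊕ q^ suc k ⊛ (1-q^ suc k ⊛ homogeneous n (suc k))
    ≈⟨ ⊕-congˡ {1-q^ suc k ⊛ homogeneous (suc n) k} 
         (⊛-congˡ {q^ suc k} (≈-trans (raise-degree n k) (≈-sym (raise-vars n k)))) ⟩
  1-q^ suc k ⊛ homogeneous (suc n) k ⊕ q^ suc k ⊛ (1-q^ n ⊛ homogeneous (suc n) k)
    ≈⟨ 1-q^-+-⊛ (suc k) n (homogeneous (suc n) k) ⟨
  1-q^ (suc k + n) ⊛ homogeneous (suc n) k
    ≡⟨ cong (λ a → 1-q^ a ⊛ homogeneous (suc n) k) (ℕₚ.+-suc k n) ⟨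
  1-q^ (k + suc n) ⊛ homogeneous (suc n) k ∎
  where open ≈-Reasoning

raise-vars n zero    = ⊛-congˡ {1-q^ n} (homogeneous-zero n)
raise-vars n (suc k) = begin
  1-q^ n ⊛ homogeneous (suc n) (suc k)
    ≈⟨ ⊛-congˡ {1-q^ n} (pascal n k) ⟩
  1-q^ n ⊛ (homogeneous (suc n) k ⊕ q^ suc k ⊛ homogeneous n (suc k))
    ≈⟨ solve 4 (λ a b c d → a :* (b :+ c :* d) := a :* b :+ c :* (a :* d)) ≈-refl
         (1-q^ n) (homogeneous (suc n) k) (q^ suc k) (homogeneous n (suc k)) ⟩
  1-q^ n ⊛ homogeneous (suc n) k ⊕ q^ suc k ⊛ (1-q^ n ⊛ homogeneous n (suc k))
    ≈⟨ ⊕-congʳ (≈-trans (raise-vars n k) (≈-sym (raise-degree n k))) ⟩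
  1-q^ suc k ⊛ homogeneous n (suc k) ⊕ q^ suc k ⊛ (1-q^ n ⊛ homogeneous n (suc k))
    ≈⟨ 1-q^-+-⊛ (suc k) n (homogeneous n (suc k)) ⟨
  1-q^ (suc k + n) ⊛ homogeneous n (suc k) ∎
  where open ≈-Reasoning

-- Combinatorially this splits off the last variable x_n, of weight n, whereas the enumeration is
-- built on x_0. It is obtained instead from the raising identities, by expanding 1 - q^(k+1+n) with
-- the two summands of the exponent in the other order.
pascal′ : ∀ n k → homogeneous (suc n) (suc k) ≈ q^ n ⊛ homogeneous (suc n) k ⊕ homogeneous n (suc k)
pascal′ n k = 1-q^-cancel (suc k + n) (begin
  1-q^ (suc k + n) ⊛ H₁₁
    ≡⟨ cong (λ a → 1-q^ a ⊛ H₁₁) (ℕₚ.+-comm (suc k) n) ⟩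
  1-q^ (n + suc k) ⊛ H₁₁
    ≈⟨ 1-q^-+-⊛ n (suc k) H₁₁ ⟩
  1-q^ n ⊛ H₁₁ ⊕ q^ n ⊛ (1-q^ suc k ⊛ H₁₁)
    ≈⟨ ⊕-cong (raise-vars n (suc k)) (⊛-congˡ {q^ n} (raise-degree (suc n) k)) ⟩
  1-q^ (suc k + n) ⊛ H₀₁ ⊕ q^ n ⊛ (1-q^ (k + suc n) ⊛ H₁₀)
    ≡⟨ cong (λ a → 1-q^ (suc k + n) ⊛ H₀₁ ⊕ q^ n ⊛ (1-q^ a ⊛ H₁₀)) (ℕₚ.+-suc k n) ⟩
  1-q^ (suc k + n) ⊛ H₀₁ ⊕ q^ n ⊛ (1-q^ (suc k + n) ⊛ H₁₀)
    ≈⟨ solve 4 (λ a b c d → a :* b :+ c :* (a :* d) := a :* (c :* d :+ b)) ≈-refl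
         (1-q^ (suc k + n)) H₀₁ (q^ n) H₁₀ ⟩
  1-q^ (suc k + n) ⊛ (q^ n ⊛ H₁₀ ⊕ H₀₁) ∎)
  where
  open ≈-Reasoning
  H₁₁ = homogeneous (suc n) (suc k)
  H₁₀ = homogeneous (suc n) k
  H₀₁ = homogeneous n (suc k)

-- Both arguments of `gaussian` drop together along the product, so without its first factor the
-- product is a `gaussian` again.
gaussian-homogeneous : ∀ k m → gaussian (k + m) k ≈ homogeneous (suc m) k
gaussian-homogeneous zero    m = pointwise λ j → sym (homogeneous-zeroᵈ (suc m) j)
gaussian-homogeneous (suc k) m = begin
  ratio (suc k + m) (suc k) ⊛ gaussian (k + m) k
    ≈⟨ ⊛-congˡ {ratio (suc k + m) (suc k)} (gaussian-homogeneous k m) ⟩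
  ratio (suc k + m) (suc k) ⊛ homogeneous (suc m) k
    ≈⟨ ratio-⊛ (suc k + m) (suc k) {homogeneous (suc m) k} {homogeneous (suc m) (suc k)}
         (≈-sym (≈-trans (raise-degree (suc m) k)
         (≡⇒≈ (cong (λ a → 1-q^ a ⊛ homogeneous (suc m) k) (ℕₚ.+-suc k m))))) ⟩
  homogeneous (suc m) (suc k) ∎
  where open ≈-Reasoning

-- Reciprocal polynomials

-- Here d is a formal degree: f may vanish at 0 and at d, as a polynomial shifted by a power of q
-- does. Writing i + j ≡ d avoids truncated subtraction.
record Reciprocal (d : ℕ) (f : Series) : Set where
  field
    mirror : ∀ i j → i + j ≡ d → f i ≡ f j
    beyond : ∀ i → d < i → f i ≡ 0ℤ
open Reciprocal

-- The shift stands on one side only. This is the form that suits Pascal's rules, in each of which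
-- one of the two terms is shifted and the other is not.
q^-mirror : ∀ a {d f} → Reciprocal d f → ∀ i j → i + j ≡ a + d → (q^ a ⊛ f) i ≡ f j
q^-mirror a {d} {f} r i j i+j≡a+d with a ℕₚ.≤? i
... | yes a≤i = trans
  (cong (q^ a ⊛ f) (sym (ℕₚ.m+[n∸m]≡n a≤i)))
  (trans (q^⊛-+ a f (i ∸ a)) (mirror r (i ∸ a) j (ℕₚ.+-cancelˡ-≡ a _ _ (trans
    (sym (ℕₚ.+-assoc a (i ∸ a) j)) (trans (cong (_+ j) (ℕₚ.m+[n∸m]≡n a≤i)) i+j≡a+d)))))
... | no  a≰i = trans (q^⊛-< f (ℕₚ.≰⇒> a≰i)) (sym (beyond r j (ℕₚ.+-cancelˡ-< a d j
  (subst (_< a + j) i+j≡a+d (ℕₚ.+-monoˡ-< j (ℕₚ.≰⇒> a≰i))))))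

q^-beyond : ∀ a {d f} → Reciprocal d f → ∀ i → a + d < i → (q^ a ⊛ f) i ≡ 0ℤ
q^-beyond a {d} {f} r i a+d<i = trans
  (cong (q^ a ⊛ f) (sym (ℕₚ.m+[n∸m]≡n a≤i)))
  (trans (q^⊛-+ a f (i ∸ a))
    (beyond r (i ∸ a) (ℕₚ.+-cancelˡ-< a _ _ (subst (a + d <_) (sym (ℕₚ.m+[n∸m]≡n a≤i)) a+d<i))))
  where
  a≤i = ℕₚ.≤-trans (ℕₚ.m≤m+n a d) (ℕₚ.<⇒≤ a+d<i)

q^-reciprocal : ∀ a {d f} → Reciprocal d f → Reciprocal (a + (a + d)) (q^ a ⊛ f)
q^-reciprocal a {d} {f} r .beyond i <i = q^-beyond a r i (ℕₚ.≤-<-trans (ℕₚ.m≤n+m (a + d) a) <i)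
q^-reciprocal a {d} {f} r .mirror i j i+j≡ with a ℕₚ.≤? j
... | yes a≤j = trans
  (q^-mirror a r i (j ∸ a) (ℕₚ.+-cancelˡ-≡ a _ _ (trans (cong (a +_) (ℕₚ.+-comm i (j ∸ a))) (trans
    (sym (ℕₚ.+-assoc a (j ∸ a) i)) (trans (cong (_+ i) (ℕₚ.m+[n∸m]≡n a≤j)) (trans (ℕₚ.+-comm j i) i+j≡))))))
  (trans (sym (q^⊛-+ a f (j ∸ a))) (cong (q^ a ⊛ f) (ℕₚ.m+[n∸m]≡n a≤j)))
... | no  a≰j = trans
  (q^-beyond a r i (ℕₚ.+-cancelˡ-< a (a + d) i
    (subst (_< a + i) (trans (ℕₚ.+-comm j i) i+j≡) (ℕₚ.+-monoˡ-< i (ℕₚ.≰⇒> a≰j)))))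
  (sym (q^⊛-< f (ℕₚ.≰⇒> a≰j)))

-- Reflection moves the power of q from one term to the other and so carries the first Pascal rule
-- into the second.
homogeneous-reciprocal : ∀ m k → Reciprocal (m * k) (homogeneous (suc m) k)
homogeneous-reciprocal m zero .mirror i j i+j≡ rewrite ℕₚ.*-zeroʳ m with i | j | i+j≡
... | zero | zero | refl = refl
homogeneous-reciprocal m zero .beyond (suc i) _ = homogeneous-zeroᵈ (suc m) (suc i)
homogeneous-reciprocal zero (suc k) .mirror zero zero _ = refl
homogeneous-reciprocal zero (suc k) .beyond i 0<i = trans (pascal 0 k .at i)
  (cong₂ ℤ._+_ (homogeneous-reciprocal zero k .beyond i 0<i) (⊛-zeroʳ-≈ (q^ suc k) .at i))
homogeneous-reciprocal (suc m) (suc k) .mirror i j i+j≡d = trans (pascal (suc m) k .at i) (trans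
  (cong₂ ℤ._+_
    (sym (q^-mirror (suc m) (homogeneous-reciprocal (suc m) k) j i
           (trans (ℕₚ.+-comm j i) (trans i+j≡d (ℕₚ.*-suc (suc m) k)))))
    (q^-mirror (suc k) (homogeneous-reciprocal m (suc k)) i j i+j≡d))
  (sym (pascal′ (suc m) k .at j)))
homogeneous-reciprocal (suc m) (suc k) .beyond i d<i = trans (pascal (suc m) k .at i) (cong₂ ℤ._+_
  (homogeneous-reciprocal (suc m) k .beyond i (ℕₚ.≤-<-trans (ℕₚ.*-monoʳ-≤ (suc m) (ℕₚ.n≤1+n k)) d<i))
  (q^-beyond (suc k) (homogeneous-reciprocal m (suc k)) i d<i))

-- The q-Catalan quotient in terms of Gaussian polynomials

-- The right-hand side is q^n [2n,n] + (1 + q^(2n+1)) [2n,n-1].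
module _ (n₀ : ℕ) where
  private
    n = suc n₀
    Hₙ = homogeneous (suc n) n

  catalan-closed : ratio (3 * n + 1) 1 ⊛ qCatalan n ≈
    q^ n ⊛ homogeneous (suc n) n ⊕ (homogeneous (suc (suc n)) n₀ ⊕ q^ (n + suc n) ⊛ homogeneous (suc (suc n)) n₀)
  catalan-closed = begin
    ratio (3 * n + 1) 1 ⊛ (ratio 1 (n + 1) ⊛ gaussian (2 * n) n)
      ≈⟨ ⊛-congˡ {ratio (3 * n + 1) 1} (⊛-congˡ {ratio 1 (n + 1)} (≈-trans
           (≡⇒≈ (cong (λ a → gaussian (n + a) n) (ℕₚ.+-identityʳ n))) (gaussian-homogeneous n n))) ⟩
    (1-q^ (3 * n + 1) ⊛ 1/1-q^ 1) ⊛ ((1-q^ 1 ⊛ 1/1-q^ (n + 1)) ⊛ Hₙ)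
      ≈⟨ solve 5 (λ a b c d e → (a :* b) :* ((c :* d) :* e) := (c :* b) :* ((a :* d) :* e)) ≈-refl
           (1-q^ (3 * n + 1)) (1/1-q^ 1) (1-q^ 1) (1/1-q^ (n + 1)) Hₙ ⟩
    (1-q^ 1 ⊛ 1/1-q^ 1) ⊛ (ratio (3 * n + 1) (n + 1) ⊛ Hₙ)
      ≈⟨ ⊛-congʳ {ratio (3 * n + 1) (n + 1) ⊛ Hₙ} (pointwise (1-q^-inverse 1)) ⟩
    q^ 0 ⊛ (ratio (3 * n + 1) (n + 1) ⊛ Hₙ)
      ≈⟨ ⊛-identityˡ-≈ (ratio (3 * n + 1) (n + 1) ⊛ Hₙ) ⟩
    ratio (3 * n + 1) (n + 1) ⊛ Hₙ
      -- The exponent 3n + 1 is cut into n, n + 1 and n: each outer part yields, by `lower`, the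
      -- factor 1 - q^(n+1), which the middle part has from the start.
      ≡⟨ cong₂ (λ a b → ratio a b ⊛ Hₙ)
           (exponent n)
           (ℕₚ.+-comm n 1) ⟩
    ratio (n + (suc n + n)) (suc n) ⊛ Hₙ
      ≈⟨ ratio-⊛ (n + (suc n + n)) (suc n) {Hₙ} {q^ n ⊛ Hₙ ⊕ (K ⊕ q^ (n + suc n) ⊛ K)} numerator ⟩
    q^ n ⊛ Hₙ ⊕ (K ⊕ q^ (n + suc n) ⊛ K) ∎
    where
    open ≈-Reasoning
    K = homogeneous (suc (suc n)) n₀
    exponent : ∀ n → 3 * n + 1 ≡ n + (suc n + n)
    exponent = ℕSolver.solve-∀
    lower : 1-q^ suc n ⊛ K ≈ 1-q^ n ⊛ Hₙ
    lower = ≈-trans (raise-vars (suc n) n₀) (≈-sym (raise-degree (suc n) n₀))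
    numerator : 1-q^ (n + (suc n + n)) ⊛ Hₙ ≈
                1-q^ suc n ⊛ (q^ n ⊛ Hₙ ⊕ (K ⊕ q^ (n + suc n) ⊛ K))
    numerator = begin
      1-q^ (n + (suc n + n)) ⊛ Hₙ
        ≈⟨ 1-q^-+-⊛ n (suc n + n) Hₙ ⟩
      1-q^ n ⊛ Hₙ ⊕ q^ n ⊛ (1-q^ (suc n + n) ⊛ Hₙ)
        ≈⟨ ⊕-congˡ {1-q^ n ⊛ Hₙ} (⊛-congˡ {q^ n} (1-q^-+-⊛ (suc n) n Hₙ)) ⟩
      1-q^ n ⊛ Hₙ ⊕ q^ n ⊛ (1-q^ suc n ⊛ Hₙ ⊕ q^ suc n ⊛ (1-q^ n ⊛ Hₙ))
        ≈⟨ ⊕-cong (≈-sym lower) (⊛-congˡ {q^ n} (⊕-congˡ {1-q^ suc n ⊛ Hₙ} (⊛-congˡ {q^ suc n} (≈-sym lower)))) ⟩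
      1-q^ suc n ⊛ K ⊕ q^ n ⊛ (1-q^ suc n ⊛ Hₙ ⊕ q^ suc n ⊛ (1-q^ suc n ⊛ K))
        ≈⟨ solve 5 (λ c h k u v → c :* k :+ u :* (c :* h :+ v :* (c :* k))
                 := c :* (u :* h :+ (k :+ (u :* v) :* k))) ≈-refl
             (1-q^ suc n) Hₙ K (q^ n) (q^ suc n) ⟩
      1-q^ suc n ⊛ (q^ n ⊛ Hₙ ⊕ (K ⊕ (q^ n ⊛ q^ suc n) ⊛ K))
        ≈⟨ ⊛-congˡ {1-q^ suc n} (⊕-congˡ {q^ n ⊛ Hₙ} (⊕-congˡ {K}
             (≈-trans (⊛-assoc-≈ (q^ n) (q^ suc n) K) (≈-sym (q^-assoc n (suc n) K))))) ⟩
      1-q^ suc n ⊛ (q^ n ⊛ Hₙ ⊕ (K ⊕ q^ (n + suc n) ⊛ K)) ∎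

-- That is, (1 - q^(3n+1))/(1 - q) C_n(q) + q^(n+2) [2n,n-2] = [2n+2,n].
catalan-harmonic : ∀ k → let n = 2 + k in
  ratio (3 * n + 1) 1 ⊛ qCatalan n ⊕ q^ (2 + n) ⊛ homogeneous (3 + n) k ≈ homogeneous (3 + n) n
catalan-harmonic k = begin
  ratio (3 * n + 1) 1 ⊛ qCatalan n ⊕ q^ (2 + n) ⊛ H₃
    ≈⟨ ⊕-congʳ {q^ (2 + n) ⊛ H₃} (catalan-closed (suc k)) ⟩
  q^ n ⊛ H₁ ⊕ (H₂ ⊕ q^ (n + suc n) ⊛ H₂) ⊕ q^ (2 + n) ⊛ H₃
    -- Splitting q^(2n+1) as q^n q^(n+1) exposes the second Pascal rule twice, for [2n+1,n-1] and
    -- for [2n+1,n]; the first rule then joins these two.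
    ≈⟨ ⊕-congʳ {q^ (2 + n) ⊛ H₃} (⊕-congˡ {q^ n ⊛ H₁} (⊕-congˡ {H₂} (q^-assoc n (suc n) H₂))) ⟩
  q^ n ⊛ H₁ ⊕ (H₂ ⊕ q^ n ⊛ (q^ suc n ⊛ H₂)) ⊕ q^ (2 + n) ⊛ H₃
    ≈⟨ solve 5 (λ a b c d e → a :* b :+ (c :+ a :* d) :+ e := e :+ c :+ a :* (d :+ b)) ≈-refl
         (q^ n) H₁ H₂ (q^ suc n ⊛ H₂) (q^ (2 + n) ⊛ H₃) ⟩
  (q^ (2 + n) ⊛ H₃ ⊕ H₂) ⊕ q^ n ⊛ (q^ suc n ⊛ H₂ ⊕ H₁)
    ≈⟨ ⊕-cong (pascal′ (2 + n) k) (⊛-congˡ {q^ n} (pascal′ (suc n) (suc k))) ⟨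
  homogeneous (3 + n) (suc k) ⊕ q^ n ⊛ homogeneous (2 + n) n
    ≈⟨ pascal (2 + n) (suc k) ⟨
  homogeneous (3 + n) n ∎
  where
  open ≈-Reasoning
  n = 2 + k
  H₁ = homogeneous (suc n) n
  H₂ = homogeneous (suc (suc n)) (suc k)
  H₃ = homogeneous (3 + n) k

-- Comparison of dimensions over ℤ

i*j≡0∧i≢0⇒j≡0 : ∀ i {j} → i ℤ.* j ≡ 0ℤ → i ≢ 0ℤ → j ≡ 0ℤ
i*j≡0∧i≢0⇒j≡0 i ij≡0 i≢0 = [ (λ i≡0 → contradiction i≡0 i≢0) , id ]′ (ℤₚ.i*j≡0⇒i≡0∨j≡0 i ij≡0)

∑-zero : ∀ {n} (t : Fin n → ℤ) → (∀ i → t i ≡ 0ℤ) → ∑ t ≡ 0ℤ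
∑-zero {n} t t≡0 = trans (∑.sum-cong-≗ t≡0) (∑.sum-replicate-zero n)

-- Elimination without fractions: given a pivot u ≠ 0 in the first row, every other row is
-- multiplied by u before its entry in the pivot column is cleared, and that column is dropped. A
-- dependence c of the smaller matrix lifts to one with coefficients u c_i, and u cancels because ℤ
-- is a domain.
independent-rows⇒≤ : ∀ {a b} (w : Fin a → Fin b → ℤ) →
  (∀ (c : Fin a → ℤ) → (∀ j → ∑ (λ i → c i ℤ.* w i j) ≡ 0ℤ) → ∀ i → c i ≡ 0ℤ) → a ≤ b
independent-rows⇒≤ {zero} w _ = z≤n
independent-rows⇒≤ {suc a} {b} w indep with Finₚ.any? (λ j → ¬? (w Fin.zero j ℤₚ.≟ 0ℤ))
-- A zero first row is a dependence by itself; this covers b = 0.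
... | no  ∄j = contradiction (indep first first-vanishes Fin.zero) λ ()
  where
  first : Fin (suc a) → ℤ
  first Fin.zero    = 1ℤ
  first (Fin.suc _) = 0ℤ
  first-vanishes : ∀ j → ∑ (λ i → first i ℤ.* w i j) ≡ 0ℤ
  first-vanishes j = cong₂ ℤ._+_
    (trans (ℤₚ.*-identityˡ (w Fin.zero j)) (decidable-stable (w Fin.zero j ℤₚ.≟ 0ℤ) λ w≢0 → ∄j (j , w≢0)))
    (∑-zero {a} _ λ _ → refl)
independent-rows⇒≤ {suc a} {suc b} w indep | yes (p , u≢0) =
  s≤s (independent-rows⇒≤ w′ λ c c-vanishes i →
    i*j≡0∧i≢0⇒j≡0 u (indep (extend c) (extend-vanishes c c-vanishes) (Fin.suc i)) u≢0)
  where
  u = w Fin.zero p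
  w′ : Fin a → Fin b → ℤ
  w′ i j = u ℤ.* w (Fin.suc i) (punchIn p j) ℤ.- w (Fin.suc i) p ℤ.* w Fin.zero (punchIn p j)
  extend : (Fin a → ℤ) → Fin (suc a) → ℤ
  extend c Fin.zero    = ℤ.- ∑ (λ i → c i ℤ.* w (Fin.suc i) p)
  extend c (Fin.suc i) = u ℤ.* c i
  combination : ∀ c j → ∑ (λ i → extend c i ℤ.* w i j) ≡
    ∑ (λ i → c i ℤ.* (u ℤ.* w (Fin.suc i) j ℤ.- w (Fin.suc i) p ℤ.* w Fin.zero j))
  combination c j = trans
    (cong₂ ℤ._+_
      (trans (sym (ℤₚ.neg-distribˡ-* S x)) (trans (ℤₚ.neg-distribʳ-* S x)
        (∑.*-distribʳ-sum (ℤ.- x) (λ i → c i ℤ.* w (Fin.suc i) p))))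
      refl)
    (trans
      (sym (∑.∑-distrib-+ (λ i → c i ℤ.* w (Fin.suc i) p ℤ.* (ℤ.- x)) (λ i → u ℤ.* c i ℤ.* w (Fin.suc i) j)))
      (∑.sum-cong-≗ λ i →
      lemma (c i) (w (Fin.suc i) p) x u (w (Fin.suc i) j)))
    where
    S = ∑ (λ i → c i ℤ.* w (Fin.suc i) p)
    x = w Fin.zero j
    lemma : ∀ c y x u z → (c ℤ.* y) ℤ.* (ℤ.- x) ℤ.+ (u ℤ.* c) ℤ.* z ≡ c ℤ.* (u ℤ.* z ℤ.- y ℤ.* x)
    lemma = solve-∀
  extend-vanishes : ∀ c → (∀ j → ∑ (λ i → c i ℤ.* w′ i j) ≡ 0ℤ) →
                    ∀ j → ∑ (λ i → extend c i ℤ.* w i j) ≡ 0ℤ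
  extend-vanishes c c-vanishes j with p Finₚ.≟ j
  ... | yes refl = trans (combination c p) (∑-zero _ λ i → lemma (c i) u (w (Fin.suc i) p))
    where
    lemma : ∀ c u y → c ℤ.* (u ℤ.* y ℤ.- y ℤ.* u) ≡ 0ℤ
    lemma = solve-∀
  ... | no p≢j = subst (λ j → ∑ (λ i → extend c i ℤ.* w i j) ≡ 0ℤ) (Finₚ.punchIn-punchOut p≢j)
    (trans (combination c (punchIn p (punchOut p≢j))) (c-vanishes (punchOut p≢j)))

module _ {A : Set} (_≟_ : DecidableEquality A) where

  δ : A → A → ℤ
  δ x a = if does (x ≟ a) then 1ℤ else 0ℤ

  combine : (xs : List A) → (Fin (length xs) → ℤ) → A → ℤ
  combine []       c a = 0ℤ
  combine (x ∷ xs) c a = c Fin.zero ℤ.* δ x a ℤ.+ combine xs (c ∘ Fin.suc) a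

  combine-∉ : ∀ xs c {a} → a ∉ xs → combine xs c a ≡ 0ℤ
  combine-∉ []       c a∉ = refl
  combine-∉ (x ∷ xs) c {a} a∉ = cong₂ ℤ._+_
    (trans (cong (λ b → c Fin.zero ℤ.* (if b then 1ℤ else 0ℤ)) (dec-false (x ≟ a) λ { refl → a∉ (here refl) }))
           (ℤₚ.*-zeroʳ (c Fin.zero)))
    (combine-∉ xs (c ∘ Fin.suc) (a∉ ∘ there))

  combine-injective : ∀ {xs} → Unique xs → ∀ c → (∀ a → combine xs c a ≡ 0ℤ) → ∀ i → c i ≡ 0ℤ
  combine-injective {x ∷ xs} (x≢ ∷ unique) c vanish = λ where
      Fin.zero    → c₀≡0
      (Fin.suc i) → combine-injective unique (c ∘ Fin.suc) tail-vanish i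
    where
    c₀≡0 : c Fin.zero ≡ 0ℤ
    c₀≡0 = trans (sym (trans
      (cong₂ ℤ._+_
        (trans (cong (λ b → c Fin.zero ℤ.* (if b then 1ℤ else 0ℤ)) (dec-true (x ≟ x) refl))
               (ℤₚ.*-identityʳ (c Fin.zero)))
        (combine-∉ xs (c ∘ Fin.suc) λ x∈ → All.lookup x≢ x∈ refl))
      (ℤₚ.+-identityʳ (c Fin.zero)))) (vanish x)
    tail-vanish : ∀ a → combine xs (c ∘ Fin.suc) a ≡ 0ℤ
    tail-vanish a = trans (sym (trans
      (cong (λ t → t ℤ.* δ x a ℤ.+ combine xs (c ∘ Fin.suc) a) c₀≡0) (ℤₚ.+-identityˡ _)))
      (vanish a)

  -- The indicator functions of the entries of `xs` are a basis of the functions supported there,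
  -- and their images, read off on `ys`, are independent rows. Repetitions in `ys` would merely
  -- repeat columns.
  injective⇒length≤ : ∀ {B : Set} {xs : List A} (ys : List B) (L : (A → ℤ) → B → ℤ) →
    (∀ f g b → L (λ a → f a ℤ.+ g a) b ≡ L f b ℤ.+ L g b) →
    (∀ c f b → L (λ a → c ℤ.* f a) b ≡ c ℤ.* L f b) →
    Unique xs →
    (∀ f → (∀ {a} → a ∉ xs → f a ≡ 0ℤ) → (∀ {b} → b ∈ ys → L f b ≡ 0ℤ) → ∀ a → f a ≡ 0ℤ) →
    length xs ≤ length ys
  injective⇒length≤ {B} {xs} ys L L-+ L-* unique injective =
    independent-rows⇒≤ (λ i j → L (δ (lookup xs i)) (lookup ys j)) λ c vanishes →
      combine-injective unique c (injective (combine xs c) (combine-∉ xs c) λ {b} b∈ → trans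
        (L-combine xs c b)
        (subst (λ b → ∑ (λ i → c i ℤ.* L (δ (lookup xs i)) b) ≡ 0ℤ)
               (sym (lookup-index b∈)) (vanishes (index b∈))))
    where
    L-combine : ∀ xs c b → L (combine xs c) b ≡ ∑ (λ i → c i ℤ.* L (δ (lookup xs i)) b)
    L-combine []       c b = L-* 0ℤ (λ _ → 0ℤ) b
    L-combine (x ∷ xs) c b = trans
      (L-+ (λ a → c Fin.zero ℤ.* δ x a) (combine xs (c ∘ Fin.suc)) b)
      (cong₂ ℤ._+_ (L-* (c Fin.zero) (δ x) b) (L-combine xs (c ∘ Fin.suc) b))

-- Differential operators on polynomials

-- A family of coefficients indexed by exponent vectors, of possibly infinite support. Finiteness
-- enters only with the monomials of fixed degree and weight.
Polynomial : ℕ → Set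
Polynomial n = Vec ℕ n → ℤ

record Operator (n : ℕ) : Set where
  field
    apply  : Polynomial n → Polynomial n
    cong-≗ : ∀ {p r} → p ≗ r → apply p ≗ apply r
    +-homo : ∀ p r v → apply (λ u → p u ℤ.+ r u) v ≡ apply p v ℤ.+ apply r v
    *-homo : ∀ c p v → apply (λ u → c ℤ.* p u) v ≡ c ℤ.* apply p v

  0-homo : ∀ {p} → (∀ u → p u ≡ 0ℤ) → ∀ v → apply p v ≡ 0ℤ
  0-homo p≡0 v = trans (cong-≗ p≡0 v) (*-homo 0ℤ (λ _ → 0ℤ) v)

open Operator

operatorRing : ℕ → Ring 0ℓ 0ℓ
operatorRing n = record
  { Carrier = Operator n
  ; _≈_ = λ A B → ∀ p v → apply A p v ≡ apply B p v
  ; _+_ = λ A B → record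
    { apply  = λ p v → apply A p v ℤ.+ apply B p v
    ; cong-≗ = λ e v → cong₂ ℤ._+_ (cong-≗ A e v) (cong-≗ B e v)
    ; +-homo = λ p r v → trans (cong₂ ℤ._+_ (+-homo A p r v) (+-homo B p r v))
        (interchange ℤₚ.+-commutativeSemigroup (apply A p v) (apply A r v) (apply B p v) (apply B r v))
    ; *-homo = λ c p v → trans (cong₂ ℤ._+_ (*-homo A c p v) (*-homo B c p v))
        (sym (ℤₚ.*-distribˡ-+ c (apply A p v) (apply B p v)))
    }
  ; _*_ = λ A B → record
    { apply  = apply A ∘ apply B
    ; cong-≗ = cong-≗ A ∘ cong-≗ B
    ; +-homo = λ p r v → trans (cong-≗ A (+-homo B p r) v) (+-homo A (apply B p) (apply B r) v)
    ; *-homo = λ c p v → trans (cong-≗ A (*-homo B c p) v) (*-homo A c (apply B p) v)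
    }
  ; -_ = λ A → record
    { apply  = λ p v → ℤ.- apply A p v
    ; cong-≗ = λ e v → cong ℤ.-_ (cong-≗ A e v)
    ; +-homo = λ p r v → trans (cong ℤ.-_ (+-homo A p r v)) (ℤₚ.neg-distrib-+ (apply A p v) (apply A r v))
    ; *-homo = λ c p v → trans (cong ℤ.-_ (*-homo A c p v)) (ℤₚ.neg-distribʳ-* c (apply A p v))
    }
  ; 0# = record
    { apply = λ _ _ → 0ℤ ; cong-≗ = λ _ _ → refl
    ; +-homo = λ _ _ _ → refl ; *-homo = λ c _ _ → sym (ℤₚ.*-zeroʳ c) }
  ; 1# = record
    { apply = id ; cong-≗ = id ; +-homo = λ _ _ _ → refl ; *-homo = λ _ _ _ → refl }
  ; isRing = record
    { +-isAbelianGroup = record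
      { isGroup = record
        { isMonoid = record
          { isSemigroup = record
            { isMagma = record
              { isEquivalence = record
                { refl  = λ _ _ → refl
                ; sym   = λ e p v → sym (e p v)
                ; trans = λ e e′ p v → trans (e p v) (e′ p v)
                }
              ; ∙-cong = λ e e′ p v → cong₂ ℤ._+_ (e p v) (e′ p v)
              }
            ; assoc = λ A B C p v → ℤₚ.+-assoc (apply A p v) (apply B p v) (apply C p v)
            }
          ; identity = (λ A p v → ℤₚ.+-identityˡ (apply A p v)) , (λ A p v → ℤₚ.+-identityʳ (apply A p v))
          }
        ; inverse = (λ A p v → ℤₚ.+-inverseˡ (apply A p v)) , (λ A p v → ℤₚ.+-inverseʳ (apply A p v))
        ; ⁻¹-cong = λ e p v → cong ℤ.-_ (e p v)
        }
      ; comm = λ A B p v → ℤₚ.+-comm (apply A p v) (apply B p v)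
      }
    ; *-cong     = λ {A} {A′} {B} {B′} e e′ p v → trans (cong-≗ A (e′ p) v) (e (apply B′ p) v)
    ; *-assoc    = λ _ _ _ _ _ → refl
    ; *-identity = (λ _ _ _ → refl) , (λ _ _ _ → refl)
    ; distrib    = (λ A B C p v → +-homo A (apply B p) (apply C p) v) , (λ _ _ _ _ _ → refl)
    }
  }

scalar : ∀ {n} → ℤ → Operator n
scalar c = record
  { apply  = λ p v → c ℤ.* p v
  ; cong-≗ = λ e v → cong (c ℤ.*_) (e v)
  ; +-homo = λ p r v → ℤₚ.*-distribˡ-+ c (p v) (r v)
  ; *-homo = λ d p v → lemma c d (p v)
  }
  where
  lemma : ∀ c d y → c ℤ.* (d ℤ.* y) ≡ d ℤ.* (c ℤ.* y)
  lemma = solve-∀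

-- The action is on coefficients, so exponents move backwards: x_0 p takes at a monomial the
-- coefficient that p has at this monomial divided by x_0.
multiply : ∀ {n} → Fin n → Polynomial n → Polynomial n
multiply Fin.zero    p (zero ∷ v)  = 0ℤ
multiply Fin.zero    p (suc a ∷ v) = p (a ∷ v)
multiply (Fin.suc i) p (a ∷ v)     = multiply i (λ u → p (a ∷ u)) v

differentiate : ∀ {n} → Fin n → Polynomial n → Polynomial n
differentiate Fin.zero    p (a ∷ v) = ℤ.+ suc a ℤ.* p (suc a ∷ v)
differentiate (Fin.suc i) p (a ∷ v) = differentiate i (λ u → p (a ∷ u)) v

x ∂ : ∀ {n} → Fin n → Operator n
x i = record { apply = multiply i ; cong-≗ = respects i ; +-homo = plus i ; *-homo = times i }
  where
  respects : ∀ {n} i {p r : Polynomial n} → p ≗ r → multiply i p ≗ multiply i r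
  respects Fin.zero    e (zero ∷ v)  = refl
  respects Fin.zero    e (suc a ∷ v) = e (a ∷ v)
  respects (Fin.suc i) e (a ∷ v)     = respects i (λ u → e (a ∷ u)) v
  plus : ∀ {n} i (p r : Polynomial n) v → multiply i (λ u → p u ℤ.+ r u) v ≡ multiply i p v ℤ.+ multiply i r v
  plus Fin.zero    p r (zero ∷ v)  = refl
  plus Fin.zero    p r (suc a ∷ v) = refl
  plus (Fin.suc i) p r (a ∷ v)     = plus i (λ u → p (a ∷ u)) (λ u → r (a ∷ u)) v
  times : ∀ {n} i c (p : Polynomial n) v → multiply i (λ u → c ℤ.* p u) v ≡ c ℤ.* multiply i p v
  times Fin.zero    c p (zero ∷ v)  = sym (ℤₚ.*-zeroʳ c)
  times Fin.zero    c p (suc a ∷ v) = refl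
  times (Fin.suc i) c p (a ∷ v)     = times i c (λ u → p (a ∷ u)) v
∂ i = record { apply = differentiate i ; cong-≗ = respects i ; +-homo = plus i ; *-homo = times i }
  where
  respects : ∀ {n} i {p r : Polynomial n} → p ≗ r → differentiate i p ≗ differentiate i r
  respects Fin.zero    e (a ∷ v) = cong (ℤ.+ suc a ℤ.*_) (e (suc a ∷ v))
  respects (Fin.suc i) e (a ∷ v) = respects i (λ u → e (a ∷ u)) v
  plus : ∀ {n} i (p r : Polynomial n) v →
         differentiate i (λ u → p u ℤ.+ r u) v ≡ differentiate i p v ℤ.+ differentiate i r v
  plus Fin.zero    p r (a ∷ v) = ℤₚ.*-distribˡ-+ (ℤ.+ suc a) (p (suc a ∷ v)) (r (suc a ∷ v))
  plus (Fin.suc i) p r (a ∷ v) = plus i (λ u → p (a ∷ u)) (λ u → r (a ∷ u)) v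
  times : ∀ {n} i c (p : Polynomial n) v → differentiate i (λ u → c ℤ.* p u) v ≡ c ℤ.* differentiate i p v
  times Fin.zero    c p (a ∷ v) = lemma (ℤ.+ suc a) c (p (suc a ∷ v))
    where
    lemma : ∀ a c y → a ℤ.* (c ℤ.* y) ≡ c ℤ.* (a ℤ.* y)
    lemma = solve-∀
  times (Fin.suc i) c p (a ∷ v) = times i c (λ u → p (a ∷ u)) v

module _ {n : ℕ} where
  private module Op = Ring (operatorRing n)

  x-comm : ∀ i j → x i Op.* x j Op.≈ x j Op.* x i
  x-comm = go
    where
    go : ∀ {n} i j (p : Polynomial n) v → multiply i (multiply j p) v ≡ multiply j (multiply i p) v
    go Fin.zero    Fin.zero    p v           = refl
    go Fin.zero    (Fin.suc j) p (zero ∷ v)  = sym (0-homo (x j) (λ _ → refl) v)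
    go Fin.zero    (Fin.suc j) p (suc a ∷ v) = refl
    go (Fin.suc i) Fin.zero    p (zero ∷ v)  = 0-homo (x i) (λ _ → refl) v
    go (Fin.suc i) Fin.zero    p (suc a ∷ v) = refl
    go (Fin.suc i) (Fin.suc j) p (a ∷ v)     = go i j (λ u → p (a ∷ u)) v

  ∂-comm : ∀ i j → ∂ i Op.* ∂ j Op.≈ ∂ j Op.* ∂ i
  ∂-comm = go
    where
    go : ∀ {n} i j (p : Polynomial n) v → differentiate i (differentiate j p) v ≡ differentiate j (differentiate i p) v
    go Fin.zero    Fin.zero    p v       = refl
    go Fin.zero    (Fin.suc j) p (a ∷ v) = sym (*-homo (∂ j) (ℤ.+ suc a) (λ u → p (suc a ∷ u)) v)
    go (Fin.suc i) Fin.zero    p (a ∷ v) = *-homo (∂ i) (ℤ.+ suc a) (λ u → p (suc a ∷ u)) v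
    go (Fin.suc i) (Fin.suc j) p (a ∷ v) = go i j (λ u → p (a ∷ u)) v

  ∂-x : ∀ i j → ∂ i Op.* x j Op.≈ x j Op.* ∂ i Op.+ Commutator.δ (operatorRing n) i j
  ∂-x i j p v = trans (go i j p v) (cong (λ t → multiply j (differentiate i p) v ℤ.+ t) (unfold p v (does (i Finₚ.≟ j))))
    where
    unfold : ∀ p v b → (if b then p v else 0ℤ) ≡ apply (if b then Op.1# else Op.0#) p v
    unfold p v true  = refl
    unfold p v false = refl
    go : ∀ {n} i j (p : Polynomial n) v → differentiate i (multiply j p) v ≡
         multiply j (differentiate i p) v ℤ.+ (if does (i Finₚ.≟ j) then p v else 0ℤ)
    go Fin.zero Fin.zero p (zero ∷ v)  = trans (ℤₚ.*-identityˡ (p (zero ∷ v))) (sym (ℤₚ.+-identityˡ (p (zero ∷ v))))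
    go Fin.zero Fin.zero p (suc a ∷ v) = trans (ℤₚ.suc-* (ℤ.+ suc a) (p (suc a ∷ v)))
      (ℤₚ.+-comm (p (suc a ∷ v)) (ℤ.+ suc a ℤ.* p (suc a ∷ v)))
    go Fin.zero (Fin.suc j) p (a ∷ v)  = sym (trans
      (ℤₚ.+-identityʳ (multiply j (λ u → ℤ.+ suc a ℤ.* p (suc a ∷ u)) v))
      (*-homo (x j) (ℤ.+ suc a) (λ u → p (suc a ∷ u)) v))
    go (Fin.suc i) Fin.zero p (zero ∷ v)  = 0-homo (∂ i) (λ _ → refl) v
    go (Fin.suc i) Fin.zero p (suc a ∷ v) = sym (ℤₚ.+-identityʳ (differentiate i (λ u → p (a ∷ u)) v))
    go (Fin.suc i) (Fin.suc j) p (a ∷ v)  = go i j (λ u → p (a ∷ u)) v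

x∂-diagonal : ∀ {n} i (p : Polynomial n) v → multiply i (differentiate i p) v ≡ ℤ.+ Vec.lookup v i ℤ.* p v
x∂-diagonal Fin.zero    p (zero ∷ v)  = refl
x∂-diagonal Fin.zero    p (suc a ∷ v) = refl
x∂-diagonal (Fin.suc i) p (a ∷ v)     = x∂-diagonal i (λ u → p (a ∷ u)) v

-- Degrees, weights and supports

degree-updateAt : ∀ {n} (v : Vec ℕ n) i → degree (updateAt v i suc) ≡ suc (degree v)
degree-updateAt (a ∷ v) Fin.zero    = refl
degree-updateAt (a ∷ v) (Fin.suc i) = trans (cong (a +_) (degree-updateAt v i)) (ℕₚ.+-suc a (degree v))

weight-updateAt : ∀ {n} (v : Vec ℕ n) i → weight (updateAt v i suc) ≡ toℕ i + weight v
weight-updateAt (a ∷ v) Fin.zero    = refl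
weight-updateAt (a ∷ v) (Fin.suc i) = trans
  (cong₂ _+_ (degree-updateAt v i) (weight-updateAt v i))
  (cong suc (trans (sym (ℕₚ.+-assoc (degree v) (toℕ i) (weight v))) (trans
    (cong (_+ weight v) (ℕₚ.+-comm (degree v) (toℕ i))) (ℕₚ.+-assoc (toℕ i) (degree v) (weight v)))))

Supported : ∀ {n} → (Vec ℕ n → Set) → Polynomial n → Set
Supported P p = ∀ v → ¬ P v → p v ≡ 0ℤ

-- The condition on supports is phrased, here and for ∂, by adding a factor x_i to a monomial, so
-- that no exponent has to be decreased.
x-supported : ∀ {n} i {P P′ : Vec ℕ n → Set} {p} → Supported P p →
              (∀ v → P v → P′ (updateAt v i suc)) → Supported P′ (multiply i p)
x-supported Fin.zero    sp f (zero ∷ v)  ¬P′ = refl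
x-supported Fin.zero    sp f (suc a ∷ v) ¬P′ = sp (a ∷ v) (¬P′ ∘ f (a ∷ v))
x-supported (Fin.suc i) sp f (a ∷ v)     ¬P′ =
  x-supported i (λ u → sp (a ∷ u)) (λ u → f (a ∷ u)) v ¬P′

∂-supported : ∀ {n} i {P P′ : Vec ℕ n → Set} {p} → Supported P p →
              (∀ v → P (updateAt v i suc) → P′ v) → Supported P′ (differentiate i p)
∂-supported Fin.zero    sp f (a ∷ v) ¬P′ =
  trans (cong (ℤ.+ suc a ℤ.*_) (sp (suc a ∷ v) (¬P′ ∘ f (a ∷ v)))) (ℤₚ.*-zeroʳ (ℤ.+ suc a))
∂-supported (Fin.suc i) sp f (a ∷ v) ¬P′ =
  ∂-supported i (λ u → sp (a ∷ u)) (λ u → f (a ∷ u)) v ¬P′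

private module OperatorSum n = Algebra.Properties.Semiring.Sum (Ring.semiring (operatorRing n))

∑ᵒ : ∀ {n k} → (Fin k → Operator n) → Operator n
∑ᵒ {n} = OperatorSum.sum n

apply-sum : ∀ {n k} (A : Fin k → Operator n) p v →
  apply (∑ᵒ A) p v ≡ ∑ (λ i → apply (A i) p v)
apply-sum {k = zero}  A p v = refl
apply-sum {k = suc k} A p v = cong (λ t → apply (A Fin.zero) p v ℤ.+ t) (apply-sum (A ∘ Fin.suc) p v)

sum-supported : ∀ {n k P p} (A : Fin k → Operator n) → (∀ i → Supported P (apply (A i) p)) →
  Supported P (apply (∑ᵒ A) p)
sum-supported {p = p} A sA v ¬P = trans (apply-sum A p v) (∑-zero (λ i → apply (A i) p v) λ i → sA i v ¬P)

-- If DU = UD + c with c > 0 on every graded piece and D lowers the grade, then U maps no nonzero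
-- p to ker D.  The induction is on the eigenvalue problem DUp = -λp with λ ≥ 0: it passes to Dp, with a
-- larger λ.
module _ {n} (D U : Operator n) (Graded : ℕ → Polynomial n → Set)
  (graded-0 : ∀ {p} → Graded 0 p → ∀ v → p v ≡ 0ℤ)
  (lower    : ∀ {d p} → Graded (suc d) p → Graded d (apply D p))
  (commute  : ∀ {d p} → Graded (suc d) p → ∃[ c ] ∀ v →
              apply D (apply U p) v ≡ apply U (apply D p) v ℤ.+ ℤ.+ suc c ℤ.* p v)
  where

  eigenvector-zero : ∀ {d p} λ′ → Graded d p →
    (∀ v → apply D (apply U p) v ≡ ℤ.- (ℤ.+ λ′) ℤ.* p v) → ∀ v → p v ≡ 0ℤ
  eigenvector-zero {zero}      λ′ g eigen = graded-0 g
  eigenvector-zero {suc d} {p} λ′ g eigen v with commute g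
  -- By induction Dp = 0, so UDp = -(λ + c + 1)p vanishes, and the nonzero integer factor can be
  -- cancelled.
  ... | c , commuted = i*j≡0∧i≢0⇒j≡0 (ℤ.- (ℤ.+ (λ′ + suc c)))
        (trans (sym (UDp v)) (0-homo U (eigenvector-zero (λ′ + suc c) (lower g) eigen′) v))
        (nonzero λ′)
    where
    nonzero : ∀ a → ℤ.- (ℤ.+ (a + suc c)) ≢ 0ℤ
    nonzero zero    ()
    nonzero (suc a) ()
    lemma : ∀ a b y z → ℤ.- a ℤ.* y ≡ z ℤ.+ b ℤ.* y → z ≡ ℤ.- (a ℤ.+ b) ℤ.* y
    lemma a b y z e = trans (l₁ z (b ℤ.* y)) (trans (cong (λ t → t ℤ.- b ℤ.* y) (sym e)) (l₂ a b y))
      where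
      l₁ : ∀ z w → z ≡ (z ℤ.+ w) ℤ.- w
      l₁ = solve-∀
      l₂ : ∀ a b y → ℤ.- a ℤ.* y ℤ.- b ℤ.* y ≡ ℤ.- (a ℤ.+ b) ℤ.* y
      l₂ = solve-∀
    UDp : ∀ v → apply U (apply D p) v ≡ ℤ.- (ℤ.+ (λ′ + suc c)) ℤ.* p v
    UDp v = lemma (ℤ.+ λ′) (ℤ.+ suc c) (p v) _ (trans (sym (eigen v)) (commuted v))
    eigen′ : ∀ v → apply D (apply U (apply D p)) v ≡ ℤ.- (ℤ.+ (λ′ + suc c)) ℤ.* apply D p v
    eigen′ v = trans (cong-≗ D UDp v) (*-homo D (ℤ.- (ℤ.+ (λ′ + suc c))) p v)

  raising-injective : ∀ {d p} → Graded d p → (∀ v → apply D (apply U p) v ≡ 0ℤ) → ∀ v → p v ≡ 0ℤ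
  raising-injective g DUp≡0 = eigenvector-zero 0 g DUp≡0

-- Harmonic polynomials

alternating : ℕ → ℤ
alternating zero    = 1ℤ
alternating (suc n) = ℤ.- alternating n

alternating-+ : ∀ a b → alternating (a + b) ≡ alternating a ℤ.* alternating b
alternating-+ zero    b = sym (ℤₚ.*-identityˡ (alternating b))
alternating-+ (suc a) b = trans (cong ℤ.-_ (alternating-+ a b)) (ℤₚ.neg-distribˡ-* (alternating a) (alternating b))

alternating-square : ∀ a → alternating a ℤ.* alternating a ≡ 1ℤ
alternating-square zero    = refl
alternating-square (suc a) = trans (lemma (alternating a)) (alternating-square a)
  where
  lemma : ∀ y → (ℤ.- y) ℤ.* (ℤ.- y) ≡ y ℤ.* y
  lemma = solve-∀

toℕ-opposite : ∀ {n} (i : Fin n) → toℕ (opposite i) + suc (toℕ i) ≡ n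
toℕ-opposite {n} i = trans (cong (_+ suc (toℕ i)) (Finₚ.opposite-prop i)) (ℕₚ.m∸n+n≡m (Finₚ.toℕ<n i))

-- The exponents m - 1 - l and l + 1 add up to m = 2h, so their signs have product 1. This is where
-- the evenness of m provides the signs of `X`.
alternating-opposite : ∀ h (l : Fin (h + h)) → alternating (toℕ (opposite l)) ≡ ℤ.- alternating (toℕ l)
alternating-opposite h l = lemma (alternating (toℕ (opposite l))) (alternating (toℕ l))
  (alternating-square (toℕ l))
  (trans (sym (alternating-+ (toℕ (opposite l)) (suc (toℕ l))))
    (trans (cong alternating (toℕ-opposite l)) (trans (alternating-+ h h) (alternating-square h))))
  where
  lemma : ∀ y z → z ℤ.* z ≡ 1ℤ → y ℤ.* (ℤ.- z) ≡ 1ℤ → y ≡ ℤ.- z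
  lemma y z zz≡1 yz≡-1 = trans (sym (ℤₚ.*-identityʳ y)) (trans (cong (y ℤ.*_) (sym zz≡1)) (trans (l₁ y z)
    (trans (cong (λ t → ℤ.- (t ℤ.* z)) yz≡-1) (cong ℤ.-_ (ℤₚ.*-identityˡ z)))))
    where
    l₁ : ∀ y z → y ℤ.* (z ℤ.* z) ≡ ℤ.- ((y ℤ.* ℤ.- z) ℤ.* z)
    l₁ = solve-∀

-- The constant c is general because passing to the tail of v renumbers the variables and so
-- replaces c by c - 2.
∑-lookup-degree : ∀ {n} c (v : Vec ℕ n) →
  ∑ (λ i → (c ℤ.- ℤ.+ 2 ℤ.* ℤ.+ toℕ i) ℤ.* ℤ.+ Vec.lookup v i) ≡ c ℤ.* ℤ.+ degree v ℤ.- ℤ.+ 2 ℤ.* ℤ.+ weight v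
∑-lookup-degree c []      = lemma c
  where
  lemma : ∀ c → 0ℤ ≡ c ℤ.* 0ℤ ℤ.- ℤ.+ 2 ℤ.* 0ℤ
  lemma = solve-∀
∑-lookup-degree c (a ∷ v) = trans
  (cong (λ t → (c ℤ.- ℤ.+ 2 ℤ.* 0ℤ) ℤ.* ℤ.+ a ℤ.+ t) (trans
    (∑.sum-cong-≗ λ i → shift-index c (ℤ.+ toℕ i) (ℤ.+ Vec.lookup v i))
    (∑-lookup-degree (c ℤ.- ℤ.+ 2) v)))
  (lemma c (ℤ.+ a) (ℤ.+ degree v) (ℤ.+ weight v))
  where
  shift-index : ∀ c i y → (c ℤ.- ℤ.+ 2 ℤ.* (1ℤ ℤ.+ i)) ℤ.* y ≡ (c ℤ.- ℤ.+ 2 ℤ.- ℤ.+ 2 ℤ.* i) ℤ.* y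
  shift-index = solve-∀
  lemma : ∀ c a d w → (c ℤ.- ℤ.+ 2 ℤ.* 0ℤ) ℤ.* a ℤ.+ ((c ℤ.- ℤ.+ 2) ℤ.* d ℤ.- ℤ.+ 2 ℤ.* w) ≡
                      c ℤ.* (a ℤ.+ d) ℤ.- ℤ.+ 2 ℤ.* (d ℤ.+ w)
  lemma = solve-∀

-- (l + 1)(m - l), the coefficient in YX e_l = (l + 1)(m - l) e_l on the irreducible sl₂-module of highest weight m
ladder : ℕ → ℕ → ℤ
ladder m l = ℤ.+ suc l ℤ.* (ℤ.+ m ℤ.- ℤ.+ l)

-- Summation by parts: the exponent of x_i receives the factor (i + 1)(m - i) - i(m - i + 1) = m -
-- 2i, its sl₂-weight. Both sums can run over all variables, since (m + 1)(m - m) and the factor i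
-- at i = 0 vanish.
∑-ladder : ∀ {m} (v : Vec ℕ (suc m)) →
  ∑ (λ (l : Fin m) → ladder m (toℕ l) ℤ.* (ℤ.+ Vec.lookup v (inject₁ l) ℤ.- ℤ.+ Vec.lookup v (Fin.suc l))) ≡
  ℤ.+ m ℤ.* ℤ.+ degree v ℤ.- ℤ.+ 2 ℤ.* ℤ.+ weight v
∑-ladder {m} v = begin
  ∑ (λ (l : Fin m) → ladder m (toℕ l) ℤ.* (a (inject₁ l) ℤ.- a (Fin.suc l)))
    ≡⟨ ∑.sum-cong-≗ (λ l → trans (ℤₚ.*-distribˡ-+ (ladder m (toℕ l)) (a (inject₁ l)) (ℤ.- a (Fin.suc l)))
         (cong₂ ℤ._+_ (cong (λ k → ladder m k ℤ.* a (inject₁ l)) (sym (Finₚ.toℕ-inject₁ l)))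
           (next (ℤ.+ toℕ l) (ℤ.+ m) (a (Fin.suc l))))) ⟩
  ∑ (λ l → out (inject₁ l) ℤ.+ ℤ.- into (Fin.suc l))
    ≡⟨ ∑.∑-distrib-+ (out ∘ inject₁) (λ l → ℤ.- into (Fin.suc l)) ⟩
  ∑ (out ∘ inject₁) ℤ.+ ∑ (λ l → ℤ.- into (Fin.suc l))
    ≡⟨ cong₂ ℤ._+_
         (sym (trans (∑.sum-init-last out) (trans
           (cong (λ t → ∑ (out ∘ inject₁) ℤ.+ t) out-last) (ℤₚ.+-identityʳ (∑ (out ∘ inject₁))))))
         (sym (ℤₚ.+-identityˡ (∑ (λ l → ℤ.- into (Fin.suc l))))) ⟩
  ∑ out ℤ.+ ∑ (λ i → ℤ.- into i)
    ≡⟨ ∑.∑-distrib-+ out (λ i → ℤ.- into i) ⟨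
  ∑ (λ i → out i ℤ.- into i)
    ≡⟨ ∑.sum-cong-≗ (λ i → difference (ℤ.+ toℕ i) (ℤ.+ m) (a i)) ⟩
  ∑ (λ i → (ℤ.+ m ℤ.- ℤ.+ 2 ℤ.* ℤ.+ toℕ i) ℤ.* a i)
    ≡⟨ ∑-lookup-degree (ℤ.+ m) v ⟩
  ℤ.+ m ℤ.* ℤ.+ degree v ℤ.- ℤ.+ 2 ℤ.* ℤ.+ weight v ∎
  where
  open ≡-Reasoning
  a : Fin (suc m) → ℤ
  a i = ℤ.+ Vec.lookup v i
  out into : Fin (suc m) → ℤ
  out i  = ladder m (toℕ i) ℤ.* a i
  into i = ℤ.+ toℕ i ℤ.* (1ℤ ℤ.+ ℤ.+ m ℤ.- ℤ.+ toℕ i) ℤ.* a i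
  next : ∀ l m y → (1ℤ ℤ.+ l) ℤ.* (m ℤ.- l) ℤ.* (ℤ.- y) ≡ ℤ.- ((1ℤ ℤ.+ l) ℤ.* (1ℤ ℤ.+ m ℤ.- (1ℤ ℤ.+ l)) ℤ.* y)
  next = solve-∀
  difference : ∀ i m y → (1ℤ ℤ.+ i) ℤ.* (m ℤ.- i) ℤ.* y ℤ.- i ℤ.* (1ℤ ℤ.+ m ℤ.- i) ℤ.* y ≡ (m ℤ.- ℤ.+ 2 ℤ.* i) ℤ.* y
  difference = solve-∀
  out-last : out (fromℕ m) ≡ 0ℤ
  out-last = trans (cong (λ k → ladder m k ℤ.* a (fromℕ m)) (Finₚ.toℕ-fromℕ m)) (lemma (ℤ.+ m) (a (fromℕ m)))
    where
    lemma : ∀ m y → (1ℤ ℤ.+ m) ℤ.* (m ℤ.- m) ℤ.* y ≡ 0ℤ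
    lemma = solve-∀

∑-lookup : ∀ {n} (v : Vec ℕ n) y → ∑ (λ i → ℤ.+ Vec.lookup v i ℤ.* y) ≡ ℤ.+ degree v ℤ.* y
∑-lookup []      y = refl
∑-lookup (a ∷ v) y = trans (cong (λ t → ℤ.+ a ℤ.* y ℤ.+ t) (∑-lookup v y))
  (sym (ℤₚ.*-distribʳ-+ y (ℤ.+ a) (ℤ.+ degree v)))

∑-const : ∀ n y → ∑ {n} (λ _ → y) ≡ ℤ.+ n ℤ.* y
∑-const zero    y = refl
∑-const (suc n) y = trans (cong (λ t → y ℤ.+ t) (∑-const n y)) (sym (ℤₚ.suc-* (ℤ.+ n) y))

scalar-supported : ∀ {n} c {P : Vec ℕ n → Set} {p} → Supported P p → Supported P (λ v → c ℤ.* p v)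
scalar-supported c sp v ¬P = trans (cong (c ℤ.*_) (sp v ¬P)) (ℤₚ.*-zeroʳ c)

zero-outside : ∀ {n} {P : Vec ℕ n → Set} {p} → Supported P p → (∀ v → Dec (P v)) →
               (∀ v → P v → p v ≡ 0ℤ) → ∀ v → p v ≡ 0ℤ
zero-outside sp P? zero-on v with P? v
... | yes Pv = zero-on v Pv
... | no ¬Pv = sp v ¬Pv

module Harmonic (h : ℕ) where
  m n : ℕ
  m = h + h
  n = suc m

  -- The oddness required of `X` is met by plain signs, so `Y` carries the whole factor (l + 1)(m -
  -- l). It carries the sign too: σ l is its own inverse, and no sign survives in [Y,X].
  σ τ : Fin m → ℤ
  σ l = alternating (toℕ l)
  τ l = σ l ℤ.* ladder m (toℕ l)

  private module Op = Ring (operatorRing n)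

  open Commutator (operatorRing n) using (module Weyl; swap)
  open Weyl x ∂ x-comm ∂-comm ∂-x (scalar ∘ σ) (scalar ∘ τ)
    (λ l A p v → sym (*-homo A (σ l) p v)) (λ l A p v → sym (*-homo A (τ l) p v))
    (λ l p v → trans (cong (ℤ._* p v) (alternating-opposite h l)) (sym (ℤₚ.neg-distribˡ-* (σ l) (p v))))
    public

  Δ-X : ∀ p v → apply Δ (apply X p) v ≡ apply X (apply Δ p) v
  Δ-X p v = trans (swap Δ X p v)
    (trans (cong (λ t → apply X (apply Δ p) v ℤ.+ t) ([Δ,X]≈0 p v)) (ℤₚ.+-identityʳ (apply X (apply Δ p) v)))

  -- The scalar 4d + 2(m + 1) is spelled as a successor, so that its positivity holds by
  -- computation.
  Δ-Q : ∀ p v → apply Δ (apply Q p) v ≡ apply Q (apply Δ p) v ℤ.+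
    ℤ.+ suc (suc (m + m + (degree v + degree v + degree v + degree v))) ℤ.* p v
  Δ-Q p v = trans (swap Δ Q p v) (cong (λ t → apply Q (apply Δ p) v ℤ.+ t) (trans ([Δ,Q] p v) (begin
    apply (∑ᵒ (λ i → (N i Op.+ Op.1#) Op.+ (N i Op.+ Op.1#))) p v ℤ.+ apply (∑ᵒ (λ i → N i Op.+ N i)) p v
      ≡⟨ cong₂ ℤ._+_ (apply-sum (λ i → (N i Op.+ Op.1#) Op.+ (N i Op.+ Op.1#)) p v)
           (apply-sum (λ i → N i Op.+ N i) p v) ⟩
    ∑ (λ i → (apply (N i) p v ℤ.+ p v) ℤ.+ (apply (N i) p v ℤ.+ p v)) ℤ.+
    ∑ (λ i → apply (N i) p v ℤ.+ apply (N i) p v)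
      ≡⟨ cong₂ ℤ._+_
           (trans (∑.∑-distrib-+ (λ i → apply (N i) p v ℤ.+ p v) (λ i → apply (N i) p v ℤ.+ p v))
             (cong₂ ℤ._+_ ∑N+1 ∑N+1))
           (trans (∑.∑-distrib-+ (λ i → apply (N i) p v) (λ i → apply (N i) p v)) (cong₂ ℤ._+_ ∑N ∑N)) ⟩
    ((ℤ.+ degree v ℤ.* p v ℤ.+ ℤ.+ n ℤ.* p v) ℤ.+ (ℤ.+ degree v ℤ.* p v ℤ.+ ℤ.+ n ℤ.* p v)) ℤ.+
    (ℤ.+ degree v ℤ.* p v ℤ.+ ℤ.+ degree v ℤ.* p v)
      ≡⟨ lemma (ℤ.+ m) (ℤ.+ degree v) (p v) ⟩
    ℤ.+ suc (suc (m + m + (degree v + degree v + degree v + degree v))) ℤ.* p v ∎)))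
    where
    open ≡-Reasoning
    N : Fin n → Operator n
    N i = x i Op.* ∂ i
    ∑N : ∑ (λ i → apply (N i) p v) ≡ ℤ.+ degree v ℤ.* p v
    ∑N = trans (∑.sum-cong-≗ (λ i → x∂-diagonal i p v)) (∑-lookup v (p v))
    ∑N+1 : ∑ (λ i → apply (N i) p v ℤ.+ p v) ≡ ℤ.+ degree v ℤ.* p v ℤ.+ ℤ.+ n ℤ.* p v
    ∑N+1 = trans (∑.∑-distrib-+ (λ i → apply (N i) p v) (λ _ → p v)) (cong₂ ℤ._+_ ∑N (∑-const n (p v)))
    lemma : ∀ m d y → ((d ℤ.* y ℤ.+ (1ℤ ℤ.+ m) ℤ.* y) ℤ.+ (d ℤ.* y ℤ.+ (1ℤ ℤ.+ m) ℤ.* y)) ℤ.+ (d ℤ.* y ℤ.+ d ℤ.* y) ≡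
                      (1ℤ ℤ.+ (1ℤ ℤ.+ ((m ℤ.+ m) ℤ.+ (d ℤ.+ d ℤ.+ d ℤ.+ d)))) ℤ.* y
    lemma = solve-∀

  Y-X : ∀ p v → apply Y (apply X p) v ≡ apply X (apply Y p) v ℤ.+
    (ℤ.+ m ℤ.* ℤ.+ degree v ℤ.- ℤ.+ 2 ℤ.* ℤ.+ weight v) ℤ.* p v
  Y-X p v = trans (swap Y X p v) (cong (λ t → apply X (apply Y p) v ℤ.+ t) (trans ([Y,X] p v) (begin
    apply (∑ᵒ term) p v
      ≡⟨ apply-sum term p v ⟩
    ∑ (λ l → apply (term l) p v)
      ≡⟨ ∑.sum-cong-≗ evaluate ⟩
    ∑ (λ l → ladder m (toℕ l) ℤ.* drop l ℤ.* p v)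
      ≡⟨ ∑.*-distribʳ-sum (p v) (λ l → ladder m (toℕ l) ℤ.* drop l) ⟨
    ∑ (λ l → ladder m (toℕ l) ℤ.* drop l) ℤ.* p v
      ≡⟨ cong (ℤ._* p v) (∑-ladder v) ⟩
    (ℤ.+ m ℤ.* ℤ.+ degree v ℤ.- ℤ.+ 2 ℤ.* ℤ.+ weight v) ℤ.* p v ∎)))
    where
    open ≡-Reasoning
    term : Fin m → Operator n
    term l = scalar (τ l) Op.*
      (scalar (σ l) Op.* (x (inject₁ l) Op.* ∂ (inject₁ l) Op.- x (Fin.suc l) Op.* ∂ (Fin.suc l)))
    drop : Fin m → ℤ
    drop l = ℤ.+ Vec.lookup v (inject₁ l) ℤ.- ℤ.+ Vec.lookup v (Fin.suc l)
    signs-cancel : ∀ s c a b y → s ℤ.* s ≡ 1ℤ →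
                   (s ℤ.* c) ℤ.* (s ℤ.* (a ℤ.* y ℤ.- b ℤ.* y)) ≡ c ℤ.* (a ℤ.- b) ℤ.* y
    signs-cancel s c a b y ss≡1 = trans (regroup s c a b y)
      (trans (cong (λ t → t ℤ.* (c ℤ.* (a ℤ.- b) ℤ.* y)) ss≡1) (ℤₚ.*-identityˡ (c ℤ.* (a ℤ.- b) ℤ.* y)))
      where
      regroup : ∀ s c a b y → (s ℤ.* c) ℤ.* (s ℤ.* (a ℤ.* y ℤ.- b ℤ.* y)) ≡
                              (s ℤ.* s) ℤ.* (c ℤ.* (a ℤ.- b) ℤ.* y)
      regroup = solve-∀
    evaluate : ∀ l → apply (term l) p v ≡ ladder m (toℕ l) ℤ.* drop l ℤ.* p v
    evaluate l = trans
      (cong₂ (λ y z → τ l ℤ.* (σ l ℤ.* (y ℤ.- z))) (x∂-diagonal (inject₁ l) p v) (x∂-diagonal (Fin.suc l) p v))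
      (signs-cancel (σ l) (ladder m (toℕ l)) (ℤ.+ Vec.lookup v (inject₁ l)) (ℤ.+ Vec.lookup v (Fin.suc l)) (p v)
        (alternating-square (toℕ l)))

  degree-move : ∀ (v : Vec ℕ n) i j → degree (updateAt v i suc) ≡ degree (updateAt v j suc)
  degree-move v i j = trans (degree-updateAt v i) (sym (degree-updateAt v j))

  weight-move : ∀ (v : Vec ℕ n) (l : Fin m) →
                weight (updateAt v (Fin.suc l) suc) ≡ suc (weight (updateAt v (inject₁ l) suc))
  weight-move v l = trans (weight-updateAt v (Fin.suc l))
    (cong suc (trans (cong (_+ weight v) (sym (Finₚ.toℕ-inject₁ l))) (sym (weight-updateAt v (inject₁ l)))))

  toℕ+opposite : ∀ (i : Fin n) → toℕ i + toℕ (opposite i) ≡ m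
  toℕ+opposite i = ℕₚ.suc-injective (trans (trans (cong suc (ℕₚ.+-comm (toℕ i) (toℕ (opposite i))))
    (sym (ℕₚ.+-suc (toℕ (opposite i)) (toℕ i)))) (toℕ-opposite i))

  X-supported : ∀ (P : ℕ → ℕ → Set) {p} → Supported (λ v → P (degree v) (suc (weight v))) p →
                Supported (λ v → P (degree v) (weight v)) (apply X p)
  X-supported P {p} sp = sum-supported {p = p} (λ l → scalar (σ l) Op.* (x (Fin.suc l) Op.* ∂ (inject₁ l))) λ l →
    scalar-supported (σ l) (x-supported (Fin.suc l)
      (∂-supported (inject₁ l)
        -- Between the derivative and the multiplication, a monomial is described by what it becomes
        -- once its lost factor is restored.
        {P′ = λ v → P (degree (updateAt v (inject₁ l) suc)) (suc (weight (updateAt v (inject₁ l) suc)))}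
        sp λ _ → id)
      λ v → subst₂ P (degree-move v (inject₁ l) (Fin.suc l)) (sym (weight-move v l)))

  Y-supported : ∀ (P : ℕ → ℕ → Set) {p} → Supported (λ v → P (degree v) (weight v)) p →
                Supported (λ v → P (degree v) (suc (weight v))) (apply Y p)
  Y-supported P {p} sp = sum-supported {p = p} (λ l → scalar (τ l) Op.* (x (inject₁ l) Op.* ∂ (Fin.suc l))) λ l →
    scalar-supported (τ l) (x-supported (inject₁ l)
      (∂-supported (Fin.suc l)
        {P′ = λ v → P (degree (updateAt v (Fin.suc l) suc)) (weight (updateAt v (Fin.suc l) suc))}
        sp λ _ → id)
      λ v → subst₂ P (degree-move v (Fin.suc l) (inject₁ l)) (weight-move v l))

  Q-supported : ∀ (P : ℕ → ℕ → Set) {p} → Supported (λ v → P (2 + degree v) (m + weight v)) p →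
                Supported (λ v → P (degree v) (weight v)) (apply Q p)
  Q-supported P {p} sp = sum-supported {p = p} (λ i → x i Op.* x (opposite i)) λ i →
    x-supported i (x-supported (opposite i) {P′ = λ v → P (suc (degree v)) (toℕ i + weight v)} sp
      λ v → subst₂ P (cong suc (sym (degree-updateAt v (opposite i)))) (sym (add-opposite v i)))
      λ v → subst₂ P (sym (degree-updateAt v i)) (sym (weight-updateAt v i))
    where
    add-opposite : ∀ v i → toℕ i + weight (updateAt v (opposite i) suc) ≡ m + weight v
    add-opposite v i = trans (cong (toℕ i +_) (weight-updateAt v (opposite i)))
      (trans (sym (ℕₚ.+-assoc (toℕ i) (toℕ (opposite i)) (weight v))) (cong (_+ weight v) (toℕ+opposite i)))

  Δ-supported : ∀ (P : ℕ → ℕ → Set) {p} → Supported (λ v → P (degree v) (weight v)) p →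
                Supported (λ v → P (2 + degree v) (m + weight v)) (apply Δ p)
  Δ-supported P {p} sp = sum-supported {p = p} (λ i → ∂ i Op.* ∂ (opposite i)) λ i →
    ∂-supported i (∂-supported (opposite i) {P′ = λ v → P (suc (degree v)) (toℕ (opposite i) + weight v)} sp
      λ v → subst₂ P (degree-updateAt v (opposite i)) (weight-updateAt v (opposite i)))
      λ v → subst₂ P (cong suc (degree-updateAt v i)) (add-opposite v i)
    where
    add-opposite : ∀ v i → toℕ (opposite i) + weight (updateAt v i suc) ≡ m + weight v
    add-opposite v i = trans (cong (toℕ (opposite i) +_) (weight-updateAt v i))
      (trans (sym (ℕₚ.+-assoc (toℕ (opposite i)) (toℕ i) (weight v)))
        (cong (_+ weight v) (trans (ℕₚ.+-comm (toℕ (opposite i)) (toℕ i)) (toℕ+opposite i))))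

  -- On degree k and weight j the commutator [Y,X] is mk - 2j. It is positive below the middle
  -- weight and stays so as `Y` lowers the weight, so the general lemma applies with D = Y and U =
  -- X.
  X-injective : ∀ {k j p} → 2 * j < m * k → Supported (λ v → degree v ≡ k × weight v ≡ j) p →
                (∀ v → apply X p v ≡ 0ℤ) → ∀ v → p v ≡ 0ℤ
  X-injective {k} {j} {p} 2j<mk sp Xp≡0 =
    raising-injective Y X Graded (λ g v → proj₂ g v λ ()) lower commute {suc j}
      (2j<mk , λ v ¬s → sp v λ { (d , w) → ¬s (d , cong suc w) })
      (0-homo Y Xp≡0)
    where
    -- Grade d means weight d - 1: grade 0 is the empty piece into which `Y` sends weight 0.
    Graded : ℕ → Polynomial n → Set
    Graded d p = 2 * ℕ.pred d < m * k × Supported (λ v → degree v ≡ k × suc (weight v) ≡ d) p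
    slice : ∀ {d p} → Graded (suc d) p → Supported (λ v → degree v ≡ k × weight v ≡ d) p
    slice (_ , s) v ¬s = s v λ { (d , w) → ¬s (d , ℕₚ.suc-injective w) }
    lower : ∀ {d p} → Graded (suc d) p → Graded d (apply Y p)
    lower {d} g@(2d<mk , _) = ℕₚ.≤-<-trans (ℕₚ.*-monoʳ-≤ 2 (ℕₚ.pred[n]≤n {d})) 2d<mk
      , Y-supported (λ a b → a ≡ k × b ≡ d) (slice g)
    commute : ∀ {d p} → Graded (suc d) p → ∃[ c ] ∀ v →
              apply Y (apply X p) v ≡ apply X (apply Y p) v ℤ.+ ℤ.+ suc c ℤ.* p v
    commute {d} {p} g@(2d<mk , _) = c , λ v → trans (Y-X p v)
      (cong (λ t → apply X (apply Y p) v ℤ.+ t) (eigenvalue v))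
      where
      -- The bound in `Graded` makes mk - 2d positive, that is, equal to `suc c`.
      c = m * k ∸ suc (2 * d)
      eigenvalue : ∀ v → (ℤ.+ m ℤ.* ℤ.+ degree v ℤ.- ℤ.+ 2 ℤ.* ℤ.+ weight v) ℤ.* p v ≡ ℤ.+ suc c ℤ.* p v
      eigenvalue v with (degree v ℕₚ.≟ k) ×-dec (weight v ℕₚ.≟ d)
      ... | no ¬s = trans (trans (cong ((ℤ.+ m ℤ.* ℤ.+ degree v ℤ.- ℤ.+ 2 ℤ.* ℤ.+ weight v) ℤ.*_) (slice g v ¬s))
                             (ℤₚ.*-zeroʳ (ℤ.+ m ℤ.* ℤ.+ degree v ℤ.- ℤ.+ 2 ℤ.* ℤ.+ weight v)))
                      (sym (trans (cong (ℤ.+ suc c ℤ.*_) (slice g v ¬s)) (ℤₚ.*-zeroʳ (ℤ.+ suc c))))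
      ... | yes (refl , refl) = cong (ℤ._* p v) (trans
              (cong₂ ℤ._-_ (trans (sym (ℤₚ.pos-* m k)) (cong ℤ.+_ (sym (ℕₚ.m+[n∸m]≡n 2d<mk)))) (sym (ℤₚ.pos-* 2 d)))
              (lemma (ℤ.+ (2 * d)) (ℤ.+ c)))
        where
        lemma : ∀ a c → 1ℤ ℤ.+ (a ℤ.+ c) ℤ.- a ≡ 1ℤ ℤ.+ c
        lemma = solve-∀

  Q-Δ-injective : ∀ {k p} → Supported (λ v → degree v ≡ k) p →
                  (∀ v → apply Δ (apply Q p) v ≡ 0ℤ) → ∀ v → p v ≡ 0ℤ
  Q-Δ-injective {k} sp = raising-injective Δ Q Graded graded-0 lower commute {2 + k}
    (2 + k , ℕₚ.≤-refl , λ v ¬s → sp v (¬s ∘ cong (2 +_)))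
    where
    -- Here k is the degree plus two, so that k = 0 and k = 1 stand for empty pieces. The grade d
    -- only bounds k, because `Δ` lowers the degree by two while the induction descends by one.
    Graded : ℕ → Polynomial n → Set
    Graded d p = ∃[ k ] k ≤ d × Supported (λ v → 2 + degree v ≡ k) p
    graded-0 : ∀ {p} → Graded 0 p → ∀ v → p v ≡ 0ℤ
    graded-0 (zero , _ , s) v = s v λ ()
    lower : ∀ {d p} → Graded (suc d) p → Graded d (apply Δ p)
    lower (k , k≤1+d , s) = k ∸ 2 , ℕₚ.≤-trans (ℕₚ.∸-monoˡ-≤ 2 k≤1+d) (ℕₚ.m∸n≤m _ 1)
      , λ v ¬s → Δ-supported (λ a _ → 2 + a ≡ k) s v λ { refl → ¬s refl }
    commute : ∀ {d p} → Graded (suc d) p → ∃[ c ] ∀ v →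
              apply Δ (apply Q p) v ≡ apply Q (apply Δ p) v ℤ.+ ℤ.+ suc c ℤ.* p v
    commute {d} {p} (k , _ , s) = c (k ∸ 2) , λ v → trans (Δ-Q p v)
      (cong (λ t → apply Q (apply Δ p) v ℤ.+ t) (eigenvalue v))
      where
      c : ℕ → ℕ
      c d = suc (m + m + (d + d + d + d))
      eigenvalue : ∀ v → ℤ.+ suc (c (degree v)) ℤ.* p v ≡ ℤ.+ suc (c (k ∸ 2)) ℤ.* p v
      eigenvalue v with 2 + degree v ℕₚ.≟ k
      ... | yes refl = refl
      ... | no ¬s = trans (trans (cong (ℤ.+ suc (c (degree v)) ℤ.*_) (s v ¬s)) (ℤₚ.*-zeroʳ (ℤ.+ suc (c (degree v)))))
                      (sym (trans (cong (ℤ.+ suc (c (k ∸ 2)) ℤ.*_) (s v ¬s)) (ℤₚ.*-zeroʳ (ℤ.+ suc (c (k ∸ 2))))))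

  -- If Δp = 0 and Xp + Qr = 0, then ΔQr = -XΔp = 0, so r = 0, hence Xp = 0 and p = 0.
  harmonic-injective : ∀ {k j p r} → 2 * j < m * (2 + k) →
    Supported (λ v → degree v ≡ 2 + k × weight v ≡ j) p → Supported (λ v → degree v ≡ k) r →
    (∀ v → apply X p v ℤ.+ apply Q r v ≡ 0ℤ) → (∀ v → apply Δ p v ≡ 0ℤ) →
    (∀ v → p v ≡ 0ℤ) × (∀ v → r v ≡ 0ℤ)
  harmonic-injective {p = p} {r} 2j<mk sp sr Xp+Qr≡0 Δp≡0 = X-injective 2j<mk sp Xp≡0 , r≡0
    where
    ΔXp≡0 : ∀ v → apply Δ (apply X p) v ≡ 0ℤ
    ΔXp≡0 v = trans (Δ-X p v) (0-homo X Δp≡0 v)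
    r≡0 : ∀ v → r v ≡ 0ℤ
    r≡0 = Q-Δ-injective sr λ v → trans (sym (ℤₚ.+-identityˡ (apply Δ (apply Q r) v)))
      (trans (cong (ℤ._+ apply Δ (apply Q r) v) (sym (ΔXp≡0 v)))
        (trans (sym (+-homo Δ (apply X p) (apply Q r) v)) (0-homo Δ Xp+Qr≡0 v)))
    Xp≡0 : ∀ v → apply X p v ≡ 0ℤ
    Xp≡0 v = trans
      (sym (trans (cong (λ t → apply X p v ℤ.+ t) (0-homo Q r≡0 v)) (ℤₚ.+-identityʳ (apply X p v))))
      (Xp+Qr≡0 v)

  -- The left side counts the pairs (p, r) with p of weight j and Qr of weight j + 1, the right side
  -- the possible monomials of Xp + Qr and of Δp. The shift by m is the weight of the quadratic
  -- form, which `Q` adds and `Δ` removes.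
  harmonic-growth : ∀ k j → 2 * j < m * (2 + k) →
    length (exponents n (2 + k) j) + length (shift m (exponents n k) (suc j)) ≤
    length (exponents n (2 + k) (suc j)) + length (shift m (exponents n k) j)
  harmonic-growth k j 2j<mk = subst₂ _≤_ (length-⊎ (E j) (S (suc j))) (length-⊎ (E (suc j)) (S j))
    (injective⇒length≤ (Sumₚ.≡-dec (Vecₚ.≡-dec ℕₚ._≟_) (Vecₚ.≡-dec ℕₚ._≟_))
      (E (suc j) ⊎ˡ S j) L L-+ L-* unique injective)
    where
    E S : ℕ → List (Vec ℕ n)
    E j = exponents n (2 + k) j
    S j = shift m (exponents n k) j

    _⊎ˡ_ : List (Vec ℕ n) → List (Vec ℕ n) → List (Vec ℕ n ⊎ Vec ℕ n)
    us ⊎ˡ vs = List.map inj₁ us ++ List.map inj₂ vs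

    length-⊎ : ∀ us vs → length (us ⊎ˡ vs) ≡ length us + length vs
    length-⊎ us vs = trans (Listₚ.length-++ (List.map inj₁ us))
      (cong₂ _+_ (Listₚ.length-map inj₁ us) (Listₚ.length-map inj₂ vs))

    ∈-inj₁⁻ : ∀ us vs {u} → inj₁ u ∈ us ⊎ˡ vs → u ∈ us
    ∈-inj₁⁻ us vs u∈ with ∈-++⁻ (List.map inj₁ us) u∈
    ... | inj₁ u∈ˡ with ∈-map⁻ inj₁ u∈ˡ
    ...   | _ , u∈us , refl = u∈us
    ∈-inj₁⁻ us vs u∈ | inj₂ u∈ʳ with ∈-map⁻ inj₂ u∈ʳ
    ...   | _ , _ , ()

    ∈-inj₂⁻ : ∀ us vs {v} → inj₂ v ∈ us ⊎ˡ vs → v ∈ vs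
    ∈-inj₂⁻ us vs v∈ with ∈-++⁻ (List.map inj₁ us) v∈
    ... | inj₂ v∈ʳ with ∈-map⁻ inj₂ v∈ʳ
    ...   | _ , v∈vs , refl = v∈vs
    ∈-inj₂⁻ us vs v∈ | inj₁ v∈ˡ with ∈-map⁻ inj₁ v∈ˡ
    ...   | _ , _ , ()

    L : (Vec ℕ n ⊎ Vec ℕ n → ℤ) → Vec ℕ n ⊎ Vec ℕ n → ℤ
    L f = [ (λ v → apply X (f ∘ inj₁) v ℤ.+ apply Q (f ∘ inj₂) v) , apply Δ (f ∘ inj₁) ]′

    L-+ : ∀ f g b → L (λ a → f a ℤ.+ g a) b ≡ L f b ℤ.+ L g b
    L-+ f g (inj₁ v) = trans
      (cong₂ ℤ._+_ (+-homo X (f ∘ inj₁) (g ∘ inj₁) v) (+-homo Q (f ∘ inj₂) (g ∘ inj₂) v))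
      (interchange ℤₚ.+-commutativeSemigroup (apply X (f ∘ inj₁) v) (apply X (g ∘ inj₁) v) (apply Q (f ∘ inj₂) v) (apply Q (g ∘ inj₂) v))
    L-+ f g (inj₂ v) = +-homo Δ (f ∘ inj₁) (g ∘ inj₁) v

    L-* : ∀ c f b → L (λ a → c ℤ.* f a) b ≡ c ℤ.* L f b
    L-* c f (inj₁ v) = trans (cong₂ ℤ._+_ (*-homo X c (f ∘ inj₁) v) (*-homo Q c (f ∘ inj₂) v))
      (sym (ℤₚ.*-distribˡ-+ c (apply X (f ∘ inj₁) v) (apply Q (f ∘ inj₂) v)))
    L-* c f (inj₂ v) = *-homo Δ c (f ∘ inj₁) v

    unique = Uniqueₚ.++⁺
      (Uniqueₚ.map⁺ Sumₚ.inj₁-injective (exponents-unique n (2 + k) j))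
      (Uniqueₚ.map⁺ Sumₚ.inj₂-injective (shift-unique m (suc j) (exponents-unique n k)))
      λ { (a∈ˡ , a∈ʳ) → disjoint (∈-map⁻ inj₁ a∈ˡ) (∈-map⁻ inj₂ a∈ʳ) }
      where
      disjoint : ∀ {a : Vec ℕ n ⊎ Vec ℕ n} {A B : Vec ℕ n → Set} →
                 (∃[ u ] A u × a ≡ inj₁ u) → ¬ (∃[ v ] B v × a ≡ inj₂ v)
      disjoint (_ , _ , refl) (_ , _ , ())

    E-complete : ∀ {j} v → degree v ≡ 2 + k × weight v ≡ j → v ∈ E j
    E-complete v (d , w) = subst₂ (λ k j → v ∈ exponents n k j) d w (exponents-complete v)

    S-complete : ∀ {j} v → degree v ≡ k × m + weight v ≡ j → v ∈ S j
    S-complete v (d , w) = subst₂ (λ k j → v ∈ shift m (exponents n k) j) d w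
      (∈-shift⁺ m {exponents n (degree v)} (exponents-complete v))

    S-sound : ∀ {j v} → v ∈ S j → degree v ≡ k × m + weight v ≡ j
    S-sound {j} v∈ with ∈-shift⁻ m {exponents n k} {j} v∈
    ... | i , refl , v∈′ with exponents-sound n k i v∈′
    ...   | d , w = d , cong (m +_) w

    injective : ∀ f → (∀ {a} → a ∉ E j ⊎ˡ S (suc j) → f a ≡ 0ℤ) →
                (∀ {b} → b ∈ E (suc j) ⊎ˡ S j → L f b ≡ 0ℤ) → ∀ a → f a ≡ 0ℤ
    injective f f-supp Lf≡0 = λ { (inj₁ v) → proj₁ p,r≡0 v ; (inj₂ v) → proj₂ p,r≡0 v }
      where
      p r : Polynomial n
      p = f ∘ inj₁
      r = f ∘ inj₂
      sp : Supported (λ v → degree v ≡ 2 + k × weight v ≡ j) p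
      sp v ¬s = f-supp λ v∈ → ¬s (exponents-sound n (2 + k) j (∈-inj₁⁻ (E j) (S (suc j)) v∈))
      sr : Supported (λ v → degree v ≡ k × m + weight v ≡ suc j) r
      sr v ¬s = f-supp λ v∈ → ¬s (S-sound (∈-inj₂⁻ (E j) (S (suc j)) v∈))
      Target₁ : ℕ → ℕ → Set
      Target₁ a b = a ≡ 2 + k × b ≡ suc j
      s₁ : Supported (λ v → Target₁ (degree v) (weight v)) (λ v → apply X p v ℤ.+ apply Q r v)
      s₁ v ¬s = cong₂ ℤ._+_
        (X-supported Target₁ {p} (λ u ¬t → sp u λ { (d , w) → ¬t (d , cong suc w) }) v ¬s)
        (Q-supported Target₁ {r} (λ u ¬t → sr u λ { (d , w) → ¬t (cong (2 +_) d , w) }) v ¬s)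
      p,r≡0 = harmonic-injective 2j<mk sp (λ v ¬d → sr v (¬d ∘ proj₁))
        -- `Lf≡0` speaks only of the listed monomials; at all others the supports of Xp + Qr and, in
        -- the next argument, of Δp give zero.
        (zero-outside s₁ (λ v → (degree v ℕₚ.≟ 2 + k) ×-dec (weight v ℕₚ.≟ suc j))
          λ v s → Lf≡0 (∈-++⁺ˡ (∈-map⁺ inj₁ (E-complete v s))))
        (zero-outside (Δ-supported (λ a b → a ≡ 2 + k × b ≡ j) {p} sp)
          (λ v → (2 + degree v ℕₚ.≟ 2 + k) ×-dec (m + weight v ℕₚ.≟ j))
          λ { v (d , w) → Lf≡0 (∈-++⁺ʳ (List.map inj₁ (E (suc j)))
              (∈-map⁺ inj₂ (S-complete v (ℕₚ.suc-injective (ℕₚ.suc-injective d) , w)))) })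

-- Unimodality

homogeneous-constant : ∀ n k → homogeneous (suc n) k 0 ≡ 1ℤ
homogeneous-constant n zero    = homogeneous-zeroᵈ (suc n) 0
homogeneous-constant n (suc k) = trans (pascal n k .at 0)
  (cong₂ ℤ._+_ (homogeneous-constant n k) (q^⊛-< {suc k} (homogeneous n (suc k)) (s≤s z≤n)))

-- `Reciprocal` alone bounds the degree; that it is exactly 2e follows from f(2e) = f(0) ≠ 0. The
-- decreasing half is the mirror image of the increasing one.
reciprocal-unimodal : ∀ e {f} → Reciprocal (e + e) f → f 0 ≢ 0ℤ → (∀ j → j < e → f j ℤ.≤ f (suc j)) →
                      IsSymmetricUnimodalPolynomial f
reciprocal-unimodal e {f} r f₀≢0 step = e + e
  , ((λ f≡0 → f₀≢0 (trans (r .mirror 0 (e + e) refl) f≡0)) , r .beyond)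
  , (λ k k≤d → r .mirror k (e + e ∸ k) (ℕₚ.m+[n∸m]≡n k≤d))
  , (λ i j i≤j j≤e → increasing i j i≤j (subst (j ≤_) half j≤e))
  , λ i j e≤i i≤j j≤d → subst₂ ℤ._≤_
      (r .mirror (e + e ∸ j) j (ℕₚ.m∸n+n≡m j≤d)) (r .mirror (e + e ∸ i) i (ℕₚ.m∸n+n≡m (ℕₚ.≤-trans i≤j j≤d)))
      (increasing (e + e ∸ j) (e + e ∸ i) (ℕₚ.∸-monoʳ-≤ (e + e) i≤j)
        (ℕₚ.≤-trans (ℕₚ.∸-monoʳ-≤ (e + e) (subst (_≤ i) half e≤i)) (ℕₚ.≤-reflexive (ℕₚ.m+n∸m≡n e e))))
  where
  half : ⌊ e + e /2⌋ ≡ e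
  half = sym (ℕₚ.n≡⌊n+n/2⌋ e)
  increasing : ∀ i j → i ≤ j → j ≤ e → f i ℤ.≤ f j
  increasing i zero    z≤n  _   = ℤₚ.≤-refl
  increasing i (suc j) i≤1+j 1+j≤e with ℕₚ.m≤n⇒m<n∨m≡n i≤1+j
  ... | inj₁ (s≤s i≤j) = ℤₚ.≤-trans (increasing i j i≤j (ℕₚ.<⇒≤ 1+j≤e)) (step j 1+j≤e)
  ... | inj₂ refl      = ℤₚ.≤-refl

-- Both g and h are reciprocal for the same formal degree, so f = h - g inherits its centre from
-- them, and its constant term is 1. The growth condition has the subtraction-free form that
-- counting delivers.
difference-unimodal : ∀ e {f g h} → f ⊕ g ≈ h → Reciprocal (e + e) g → Reciprocal (e + e) h →
  g 0 ≡ 0ℤ → h 0 ≡ 1ℤ → (∀ j → j < e → h j ℤ.+ g (suc j) ℤ.≤ h (suc j) ℤ.+ g j) →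
  IsSymmetricUnimodalPolynomial f
difference-unimodal e {f} {g} {h} f⊕g≈h rg rh g₀≡0 h₀≡1 growth = reciprocal-unimodal e
  (record
    { mirror = λ i j i+j≡ → trans (sym (h-g≡f i)) (trans
        (cong₂ ℤ._-_ (rh .mirror i j i+j≡) (rg .mirror i j i+j≡)) (h-g≡f j))
    ; beyond = λ i d<i → trans (sym (h-g≡f i)) (cong₂ ℤ._-_ (rh .beyond i d<i) (rg .beyond i d<i))
    })
  (λ f₀≡0 → 1≢0 (trans (sym (trans (sym (h-g≡f 0)) (cong₂ ℤ._-_ h₀≡1 g₀≡0))) f₀≡0))
  λ j j<e → subst₂ ℤ._≤_ (h-g≡f j) (h-g≡f (suc j)) (transpose (h j) (g (suc j)) (h (suc j)) (g j) (growth j j<e))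
  where
  1≢0 : 1ℤ ≢ 0ℤ
  1≢0 ()
  h-g≡f : ∀ j → h j ℤ.- g j ≡ f j
  h-g≡f j = trans (cong (ℤ._- g j) (sym (f⊕g≈h .at j))) (cancel (f j) (g j))
    where
    cancel : ∀ a b → a ℤ.+ b ℤ.- b ≡ a
    cancel = solve-∀
  transpose : ∀ a b c d → a ℤ.+ b ℤ.≤ c ℤ.+ d → a ℤ.- d ℤ.≤ c ℤ.- b
  transpose a b c d a+b≤c+d = subst₂ ℤ._≤_ (e₁ a b d) (e₂ b c d) (ℤₚ.+-monoˡ-≤ (ℤ.- b ℤ.- d) a+b≤c+d)
    where
    e₁ : ∀ a b d → a ℤ.+ b ℤ.+ (ℤ.- b ℤ.- d) ≡ a ℤ.- d
    e₁ = solve-∀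
    e₂ : ∀ b c d → c ℤ.+ d ℤ.+ (ℤ.- b ℤ.- d) ≡ c ℤ.- b
    e₂ = solve-∀

-- `Harmonic` works with m in the form h + h, while the q-Catalan identity produces 4 + k; the
-- equation between the two is eliminated here.
homogeneous-growth : ∀ h m k → h + h ≡ m → ∀ j → j < h * (2 + k) →
  homogeneous (suc m) (2 + k) j ℤ.+ (q^ m ⊛ homogeneous (suc m) k) (suc j) ℤ.≤
  homogeneous (suc m) (2 + k) (suc j) ℤ.+ (q^ m ⊛ homogeneous (suc m) k) j
homogeneous-growth h m k refl j j<he = subst₂
  (λ a b → homogeneous (suc m) (2 + k) j ℤ.+ a ℤ.≤ homogeneous (suc m) (2 + k) (suc j) ℤ.+ b)
  (length-shift m (exponents (suc m) k) (suc j)) (length-shift m (exponents (suc m) k) j)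
  (ℤ.+≤+ (Harmonic.harmonic-growth h k j
    (subst₂ _<_ (cong (j +_) (sym (ℕₚ.+-identityʳ j))) (sym (ℕₚ.*-distribʳ-+ (2 + k) h h)) (ℕₚ.+-mono-< j<he j<he))))

-- The shift by m centres the two terms at the same point: q^m [2n,n-2] has formal degree 2m + mk,
-- which equals the degree m(k + 2) of [2n+2,n].
catalan-unimodal : ∀ k h → h + h ≡ 4 + k → let n = 2 + k in
            IsSymmetricUnimodalPolynomial (ratio (3 * n + 1) 1 ⊛ qCatalan n)
catalan-unimodal k h h+h≡m = difference-unimodal (h * n)
  {ratio (3 * n + 1) 1 ⊛ qCatalan n} {q^ m ⊛ homogeneous (suc m) k} {homogeneous (suc m) n}
  (catalan-harmonic k)
  (subst (λ d → Reciprocal d (q^ m ⊛ homogeneous (suc m) k)) (trans (lemma m k) d≡)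
    (q^-reciprocal m (homogeneous-reciprocal m k)))
  (subst (λ d → Reciprocal d (homogeneous (suc m) n)) d≡ (homogeneous-reciprocal m n))
  (q^⊛-< {m} (homogeneous (suc m) k) (s≤s z≤n))
  (homogeneous-constant m n)
  (homogeneous-growth h m k h+h≡m)
  where
  n = 2 + k
  m = 2 + n
  lemma : ∀ m k → m + (m + m * k) ≡ m * (2 + k)
  lemma = ℕSolver.solve-∀
  d≡ : m * n ≡ h * n + h * n
  d≡ = trans (cong (_* n) (sym h+h≡m)) (ℕₚ.*-distribʳ-+ n h h)

theorem1p6 : ∀ (n : ℕ) → 2 ∣ n →
    IsSymmetricUnimodalPolynomial (ratio (3 * n + 1) 1 ⊛ qCatalan n)
-- From n = 2(q + 1) come k = n - 2 = 2q and h = q + 2, half of m = n + 2.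
theorem1p6 _ (divides (suc q) refl) = catalan-unimodal (q * 2) (2 + q) (lemma q)
  where
  lemma : ∀ q → (2 + q) + (2 + q) ≡ 4 + q * 2
  lemma = ℕSolver.solve-∀
-- The term [2n,n-2] presupposes n ≥ 2, so n = 0 is computed directly: the series is the constant 1,
-- with e = 0 and no growth step.
theorem1p6 _ (divides zero refl) = reciprocal-unimodal 0 {ratio 1 1 ⊛ qCatalan 0}
  (record { mirror = λ { zero zero _ → refl } ; beyond = λ { (suc i) _ → f≡1 (suc i) } })
  (λ f₀≡0 → 1≢0 (trans (sym (f≡1 0)) f₀≡0))
  (λ _ ())
  where
  1≢0 : 1ℤ ≢ 0ℤ
  1≢0 ()
  f≡1 : ratio 1 1 ⊛ qCatalan 0 ≗ q^ 0
  f≡1 = ratio-⊛ 1 1 {qCatalan 0} {q^ 0} (⊛-congˡ {1-q^ 1} (≈-trans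
    (⊛-congʳ {q^ 0} (pointwise (1-q^-inverse 1))) (⊛-identityˡ-≈ (q^ 0)))) .at
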